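{- Let $(G,L,v)$ be a reachable triple and $i\in[4]$ a color. Then one of the following holds: (1) $P(G,L,v,i,D)=\frac12$ for all integers $D\ge2$; (2) $P(G,L,v,i,D)\le\frac{13}{27}$ for all integers $D\ge 2$, and specifically $P(G,L,v,i,D)\le\frac{6}{13}$ when $\deg_G(v)\le1$. Furthermore, when $P(G,L,v,i,D)=\frac12$ for some integer $D\ge2$, one of the following three cases occurs: (a) $\deg_G(v)=0$ and $j,w\notin L(v)$ for two distinct colors $j,w$ other than $i$; (b) $\deg_G(v)=1$ and, denoting by $u$ the neighbor of $v$, $i\notin L(u)$ and $j\notin L(u)\cup L(v)$ for some color $j\neq i$; (c) $\deg_G(v)=2$ and, denoting by $u_1,u_2$ the two neighbors of $v$, the vertices $v,u_1,u_2$ form a triangle and $i\notin L(u_1)\cup L(u_2)$.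
   Context: Colors are $[4]=\{1,2,3,4\}$. A list-coloring instance $(G,L)$ is a finite simple graph $G=(V,E)$ with $L:V\to 2^{[4]}$. For a vertex $v$, $G_v$ is $G$ with $v$ and its incident edges removed, and $G_{v,w}=(G_v)_w$. If $v$ has neighbors $v_1,\dots,v_d$ (in a fixed order), then for $k\in[d]$ and a color $j$, $L_{k,j}$ is the list assignment on $G_v$ with $L_{k,j}(v_\ell)=L(v_\ell)\setminus\{j\}$ for $\ell<k$ and $L_{k,j}(u)=L(u)$ for all other vertices $u$ (so $L_{1,j}=L$). A triple $(G,L,v)$ with $v\in V$ is reachable if $\deg_G(u)\le3$ and $|L(u)|\ge\deg_G(u)+1$ for every $u\in V$, and moreover $\deg_G(v)\le2$ and $|L(v)|\ge\deg_G(v)+2$. The procedure $P(G,L,v,i,D)$ ($i\in[4]$, $D$ an integer) is defined recursively (empty products equal $1$): (a) If $i\notin L(v)$, return $0$. Otherwise, if $D\le 0$ or $\deg_G(v)=0$, return $1/|L(v)|$. (b) If $\deg_G(v)=1$ with neighbor $v_1$: let $x=P(G_v,L,v_1,i,D-1)$. If $|L(v)|=2$, say $L(v)=\{i,j\}$, let $y=P(G_v,L,v_1,j,D-1)$ and return $\frac{1-x}{2-x-y}$. If $|L(v)|=4$, return $\frac{1-x}{3}$. If $|L(v)|=3$, let $j$ be the unique color in $[4]\setminus L(v)$, $y=P(G_v,L,v_1,j,D-1)$, and return $\frac{1-x}{2+y}$. (c) If $\deg_G(v)=2$: order its neighbors $v_1,v_2$ so that $\deg_G(v_1)\ge\deg_G(v_2)$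 and, if $\deg_G(v_1)=\deg_G(v_2)=1$, so that $i\notin L(v_1)$ implies $i\notin L(v_2)$. Let $u_1,\dots,u_{d_1}$ be the neighbors of $v_1$ in $G_v$ (fixed order) and for $k\in[d_1]$, $w\in[4]$ let $L'_{k,w}$ be the list assignment on $G_{v,v_1}$ with $L'_{k,w}(u_\ell)=L(u_\ell)\setminus\{w\}$ for $\ell<k$ and $L'_{k,w}(u)=L(u)$ otherwise. Set $x_{k,w}=P(G_{v,v_1},L'_{k,w},u_k,w,D-1)$ for $k\in[d_1]$, $w\in L(v_1)$. For $j\in L(v)$ set $f_j=0$ if $j\notin L(v_1)$ and otherwise $f_j=\frac{\prod_{k=1}^{d_1}(1-x_{k,j})}{\sum_{w\in L(v_1)}\prod_{k=1}^{d_1}(1-x_{k,w})}$, and set $y_j=P(G_v,L_{2,j},v_2,j,D-1)$. Return $\frac{(1-f_i)(1-y_i)}{\sum_{j\in L(v)}(1-f_j)(1-y_j)}$. (d) If $\deg_G(v)=3$ with neighbors $v_1,v_2,v_3$: for $j\in L(v)$ let $x_j=P(G_v,L_{1,j},v_1,j,D-1)$, $y_j=P(G_v,L_{2,j},v_2,j,D-1)$, $z_j=P(G_v,L_{3,j},v_3,j,D-1)$, and return $\frac{(1-x_i)(1-y_i)(1-z_i)}{\sum_{j\in L(v)}(1-x_j)(1-y_j)(1-z_j)}$. For reachable triples, all recursive calls are again on reachable triples and case (d) never occurs. -}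

module Defs where

open import Data.Bool using (if_then_else_)
open import Data.Fin using (Fin; zero; suc; toℕ; _≟_)
open import Data.Fin.Patterns using (0F; 1F; 2F)
open import Data.Fin.Subset using (Subset; inside; outside; _∈_; _∉_; _∪_; _-_; ∁; ⊥; ∣_∣)
open import Data.Fin.Subset.Properties using (_∈?_; ∉⊥; p─q⊆p; x∈p∧x≢y⇒x∈p-y)
open import Data.Integer using (ℤ; +_; +[1+_]; -[1+_])
open import Data.List using (List; []; _∷_; allFin; foldr; length; lookup; map; take)
open import Data.List.Properties using (length-map)
import Data.List.Membership.DecPropositional as ListMembership
open import Data.List.Relation.Binary.Permutation.Propositional using (_↭_; ↭-refl; swap)
open import Data.Nat using (ℕ; suc; _≤_; _≥_) renaming (_+_ to _+ℕ_; _≟_ to _≟ℕ_)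
open import Data.Nat.Properties using (_≤?_; ≰⇒≥; ≤-reflexive)
open import Data.Product using (_×_; _,_; proj₁; proj₂; ∃-syntax)
open import Data.Rational using (ℚ; 0ℚ; 1ℚ; _+_; _*_; _/_; _÷_; ≢-nonZero) renaming (_-_ to _−_; _≟_ to _≟ℚ_)
open import Data.Vec using ([]; _∷_; there)
open import Relation.Binary.PropositionalEquality using (_≡_; _≢_; refl; sym; trans; cong)
open import Relation.Nullary using (¬_; Dec; yes; no; does; ¬?; contradiction; _×-dec_; _→-dec_)

Colour : Set
Colour = Fin 4

elements : ∀ {n} → Subset n → List (Fin n)
elements []            = []
elements (inside  ∷ p) = zero ∷ map suc (elements p)
elements (outside ∷ p) = map suc (elements p)

length-elements : ∀ {n} (p : Subset n) → length (elements p) ≡ ∣ p ∣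
length-elements []            = refl
length-elements (inside  ∷ p) = cong suc (trans (length-map suc (elements p)) (length-elements p))
length-elements (outside ∷ p) = trans (length-map suc (elements p)) (length-elements p)

x∉p-x : ∀ {n} (p : Subset n) (x : Fin n) → x ∉ p - x
x∉p-x (_ ∷ p) (suc x) (there x∈) = x∉p-x p x x∈

-- A finite simple graph whose vertex set is a subset of Fin n, so that
-- deleting a vertex does not change the type of the remaining ones.
record Graph (n : ℕ) : Set where
  field
    V         : Subset n
    nbhd      : Fin n → Subset n
    nbhd⊆V    : ∀ {u v} → u ∈ nbhd v → u ∈ V
    symmetric : ∀ {u v} → u ∈ nbhd v → v ∈ nbhd u
    loopless  : ∀ {v} → v ∉ nbhd v

open Graph public

deg : ∀ {n} → Graph n → Fin n → ℕ
deg G v = ∣ nbhd G v ∣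

neighbours : ∀ {n} → Graph n → Fin n → List (Fin n)
neighbours G v = elements (nbhd G v)

infixl 6 _∖_

-- G ∖ v is G_v.
_∖_ : ∀ {n} → Graph n → Fin n → Graph n
_∖_ {n} G v = record
  { V         = V G - v
  ; nbhd      = N
  ; nbhd⊆V    = λ {u} {w} → N⊆V u w
  ; symmetric = λ {u} {w} → N-sym u w
  ; loopless  = λ {u} → N-irr u
  }
  where
  N : Fin n → Subset n
  N u with u ≟ v
  ... | yes _ = ⊥
  ... | no  _ = nbhd G u - v

  ≢v : ∀ {p : Subset n} {u} → u ∈ p - v → u ≢ v
  ≢v {p} u∈ refl = x∉p-x p v u∈

  N⊆V : ∀ u w → u ∈ N w → u ∈ V G - v
  N⊆V u w u∈ with w ≟ v
  ... | yes _ = contradiction u∈ ∉⊥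
  ... | no  _ = x∈p∧x≢y⇒x∈p-y (nbhd⊆V G (p─q⊆p _ _ u∈)) (≢v u∈)

  N-sym : ∀ u w → u ∈ N w → w ∈ N u
  N-sym u w u∈ with w ≟ v
  ... | yes _ = contradiction u∈ ∉⊥
  ... | no w≢v with u ≟ v
  ...   | yes u≡v = contradiction u≡v (≢v u∈)
  ...   | no  _   = x∈p∧x≢y⇒x∈p-y (symmetric G (p─q⊆p _ _ u∈)) w≢v

  N-irr : ∀ u → u ∉ N u
  N-irr u u∈ with u ≟ v
  ... | yes _ = ∉⊥ u∈
  ... | no  _ = loopless G (p─q⊆p _ _ u∈)

-- Values outside the vertex set of the graph at hand are irrelevant.
ListAssignment : ℕ → Set
ListAssignment n = Fin n → Subset 4

-- For vs = v₁ ∷ … ∷ v_d this is L_{k,j}, with k counted from 0 (so the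
-- colour j is struck from the lists of the first k entries of vs).
prune : ∀ {n} → ListAssignment n → (vs : List (Fin n)) → Fin (length vs) → Colour → ListAssignment n
prune L vs k j u = if does (u ∈ˡ? take (toℕ k) vs) then L u - j else L u
  where open ListMembership _≟_ using () renaming (_∈?_ to _∈ˡ?_)

record Reachable {n} (G : Graph n) (L : ListAssignment n) (v : Fin n) : Set where
  field
    v∈V    : v ∈ V G
    deg≤3  : ∀ u → u ∈ V G → deg G u ≤ 3
    lists  : ∀ u → u ∈ V G → ∣ L u ∣ ≥ deg G u +ℕ 1
    deg≤2  : deg G v ≤ 2
    list-v : ∣ L v ∣ ≥ deg G v +ℕ 2

-- The choices left open by the procedure: the fixed order in which the
-- neighbours of a vertex are listed, and, for a vertex of degree 2, the
-- ordered pair (v₁ , v₂), which may also depend on the lists and the colour.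
record Orders (n : ℕ) : Set where
  field
    nbrs   : Graph n → Fin n → List (Fin n)
    nbrs-↭ : ∀ G v → nbrs G v ↭ neighbours G v

    pair      : Graph n → ListAssignment n → Fin n → Colour → Fin n × Fin n
    pair-↭    : ∀ G L v i → deg G v ≡ 2 →
                let (v₁ , v₂) = pair G L v i in v₁ ∷ v₂ ∷ [] ↭ neighbours G v
    pair-deg  : ∀ G L v i → deg G v ≡ 2 →
                let (v₁ , v₂) = pair G L v i in deg G v₁ ≥ deg G v₂
    pair-list : ∀ G L v i → deg G v ≡ 2 →
                let (v₁ , v₂) = pair G L v i in
                deg G v₁ ≡ 1 → deg G v₂ ≡ 1 → i ∉ L v₁ → i ∉ L v₂

-- Such choices exist: list neighbours increasingly, swapping if necessary.
increasing : ∀ n → Orders n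
increasing n = record
  { nbrs      = neighbours
  ; nbrs-↭    = λ _ _ → ↭-refl
  ; pair      = λ G L v i → choose G L i v (neighbours G v)
  ; pair-↭    = λ G L v i d → proj₁ (good G L v i d)
  ; pair-deg  = λ G L v i d → proj₁ (proj₂ (good G L v i d))
  ; pair-list = λ G L v i d → proj₂ (proj₂ (good G L v i d))
  }
  where
  module _ (G : Graph n) (L : ListAssignment n) (i : Colour) where
    Ordered : Fin n → Fin n → Set
    Ordered a b = deg G a ≥ deg G b × (deg G a ≡ 1 → deg G b ≡ 1 → i ∉ L a → i ∉ L b)

    ordered? : ∀ a b → Dec (Ordered a b)
    ordered? a b = (deg G b ≤? deg G a) ×-dec
      ((deg G a ≟ℕ 1) →-dec ((deg G b ≟ℕ 1) →-dec (¬? (i ∈? L a) →-dec ¬? (i ∈? L b))))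

    flip : ∀ a b → ¬ Ordered a b → Ordered b a
    flip a b ¬o with deg G b ≤? deg G a | i ∈? L a
    ... | no b≰a  | _      = ≰⇒≥ b≰a , λ b≡1 a≡1 → contradiction (≤-reflexive (trans b≡1 (sym a≡1))) b≰a
    ... | yes b≤a | yes i∈ = contradiction (b≤a , λ _ _ i∉ → contradiction i∈ i∉) ¬o
    ... | yes b≤a | no  i∉ with deg G a ≟ℕ 1 | deg G b ≟ℕ 1
    ...   | yes a≡1 | yes b≡1 = ≤-reflexive (trans a≡1 (sym b≡1)) , λ _ _ _ → i∉
    ...   | no  a≢1 | _       = contradiction (b≤a , λ a≡1 → contradiction a≡1 a≢1) ¬o
    ...   | _       | no  b≢1 = contradiction (b≤a , λ _ b≡1 → contradiction b≡1 b≢1) ¬o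

    choose : Fin n → List (Fin n) → Fin n × Fin n
    choose v (a ∷ b ∷ []) with ordered? a b
    ... | yes _ = a , b
    ... | no  _ = b , a
    choose v _ = v , v

    choose-good : ∀ v vs → length vs ≡ 2 →
      let (a , b) = choose v vs in (a ∷ b ∷ [] ↭ vs) × Ordered a b
    choose-good v (a ∷ b ∷ []) _ with ordered? a b
    ... | yes o = ↭-refl , o
    ... | no ¬o = swap b a ↭-refl , flip a b ¬o

  good : ∀ G L v i → deg G v ≡ 2 → _
  good G L v i d = choose-good G L i v (neighbours G v) (trans (length-elements (nbhd G v)) d)

infixl 7 _÷₀_

-- Division with the convention p ÷₀ 0 = 0.
_÷₀_ : ℚ → ℚ → ℚ
p ÷₀ q with q ≟ℚ 0ℚ
... | yes _   = 0ℚ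
... | no  q≢0 = (p ÷ q) {{≢-nonZero q≢0}}

∑ ∏ : ∀ {A : Set} → List A → (A → ℚ) → ℚ
∑ xs f = foldr _+_ 0ℚ (map f xs)
∏ xs f = foldr _*_ 1ℚ (map f xs)

reciprocal-size : Subset 4 → ℚ
reciprocal-size p = 1ℚ ÷₀ (+ ∣ p ∣ / 1)

module Procedure {n : ℕ} (O : Orders n) where
  open Orders O

  Oracle : Set
  Oracle = Graph n → ListAssignment n → Fin n → Colour → ℚ

  module Step (rec : Oracle) (G : Graph n) (L : ListAssignment n) (v : Fin n) (i : Colour) where

    -- The arguments are the elements of L(v) ∖ {i} and of [4] ∖ L(v), where
    -- i ∈ L(v); the clauses are |L(v)| = 2, 4, 3 in turn.  The last one,
    -- |L(v)| = 1, is not covered by the procedure and gets a dummy value.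
    deg-1 : Fin n → List Colour → List Colour → ℚ
    deg-1 v₁ (j ∷ []) _        = (1ℚ − x) ÷₀ (+ 2 / 1 − x − y)
      where x = rec (G ∖ v) L v₁ i
            y = rec (G ∖ v) L v₁ j
    deg-1 v₁ _        []       = (1ℚ − x) ÷₀ (+ 3 / 1)
      where x = rec (G ∖ v) L v₁ i
    deg-1 v₁ _        (j ∷ []) = (1ℚ − x) ÷₀ (+ 2 / 1 + y)
      where x = rec (G ∖ v) L v₁ i
            y = rec (G ∖ v) L v₁ j
    deg-1 v₁ _        _        = 0ℚ

    deg-2 : Fin n × Fin n → ℚ
    deg-2 (v₁ , v₂) = g i ÷₀ ∑ (elements (L v)) g
      where
      us : List (Fin n)
      us = nbrs (G ∖ v) v₁

      x : Fin (length us) → Colour → ℚ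
      x k w = rec (G ∖ v ∖ v₁) (prune L us k w) (lookup us k) w

      q : Colour → ℚ
      q w = ∏ (allFin (length us)) λ k → 1ℚ − x k w

      f y g : Colour → ℚ
      f j = if does (j ∈? L v₁) then q j ÷₀ ∑ (elements (L v₁)) q else 0ℚ
      y j = rec (G ∖ v) (prune L (v₁ ∷ v₂ ∷ []) 1F j) v₂ j
      g j = (1ℚ − f j) * (1ℚ − y j)

    deg-3 : Fin n → Fin n → Fin n → ℚ
    deg-3 v₁ v₂ v₃ = g i ÷₀ ∑ (elements (L v)) g
      where
      vs : List (Fin n)
      vs = v₁ ∷ v₂ ∷ v₃ ∷ []

      x y z g : Colour → ℚ
      x j = rec (G ∖ v) (prune L vs 0F j) v₁ j
      y j = rec (G ∖ v) (prune L vs 1F j) v₂ j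
      z j = rec (G ∖ v) (prune L vs 2F j) v₃ j
      g j = (1ℚ − x j) * (1ℚ − y j) * (1ℚ − z j)

    -- Case distinction on deg_G(v), the length of the argument; the dummy
    -- value in the last clause is for degrees above 3.
    by-degree : List (Fin n) → ℚ
    by-degree []                  = reciprocal-size (L v)
    by-degree (v₁ ∷ [])           = deg-1 v₁ (elements (L v - i)) (elements (∁ (L v)))
    by-degree (_ ∷ _ ∷ [])        = deg-2 (pair G L v i)
    by-degree (v₁ ∷ v₂ ∷ v₃ ∷ []) = deg-3 v₁ v₂ v₃
    by-degree _                   = 0ℚ

    value : ℚ
    value = if does (i ∈? L v) then by-degree (nbrs G v) else 0ℚ

  base : Oracle
  base G L v i = if does (i ∈? L v) then reciprocal-size (L v) else 0ℚ

  P : Graph n → ListAssignment n → Fin n → Colour → ℤ → ℚ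
  P G L v i -[1+ _ ] = base G L v i
  P G L v i (+ 0)    = base G L v i
  P G L v i +[1+ d ] = Step.value (λ G′ L′ v′ i′ → P G′ L′ v′ i′ (+ d)) G L v i

module _ {n} (G : Graph n) (L : ListAssignment n) (v : Fin n) (i : Colour) where

  CaseA CaseB CaseC : Set
  CaseA = deg G v ≡ 0 ×
          ∃[ j ] ∃[ w ] j ≢ w × j ≢ i × w ≢ i × j ∉ L v × w ∉ L v
  CaseB = deg G v ≡ 1 ×
          ∃[ u ] u ∈ nbhd G v × i ∉ L u × ∃[ j ] j ≢ i × j ∉ L u ∪ L v
  CaseC = deg G v ≡ 2 ×
          ∃[ u₁ ] ∃[ u₂ ] u₁ ≢ u₂ × u₁ ∈ nbhd G v × u₂ ∈ nbhd G v ×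
            u₁ ∈ nbhd G u₂ × i ∉ L u₁ ∪ L u₂

{-# OPTIONS --safe #-}
module Submission where

-- At every depth the values x = P(G,L,v,i,D) satisfy x ≤ 1/2, x = 0 if i ∉ L(v), and x ≥ 1/14 if i ∈ L(v), even
-- x ≥ 1/6 if moreover deg v ≤ 1.  A vertex u whose list misses a colour has degree at most 1 in the recursive call,
-- so for deg v = 1 the value (1 − x)/(2 + y) is 1/2 when both colours are absent from L(u), and otherwise one of
-- x, y is large enough to push it below 6/13.
-- For deg v = 2 put h_j = (1 − f_j)(1/2 − y_j) ≥ 0.  Since the f_j sum to 1, the denominator is 3/2 + Σ h_j, and the
-- value is at most 13/27 as soon as f_i ≥ 1/13, or y_i ≥ 1/14, or Σ h_j ≥ 15/26.  If i is in neither L(v₁) nor L(v₂),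
-- then v₂ has at most one further neighbour u: without one, or with u ≠ v₁, some y_j with j ≠ i stay away from 1/2 and
-- the third condition holds, whereas u = v₁ is the triangle, where y_j = 1/2 for all j ≠ i and the value is exactly 1/2.

open import Defs
open import Algebra.Definitions.RawMonoid using () renaming (_×_ to multiple)
open import Data.Bool using (if_then_else_)
open import Data.Fin using (Fin; zero; suc; toℕ; _≟_)
open import Data.Fin.Patterns using (0F; 1F; 2F; 3F)
open import Data.Fin.Properties using (suc-injective)
open import Data.Fin.Subset using (Subset; inside; outside; _∈_; _∉_; _-_; ∁; ⊤; ∣_∣; ⁅_⁆) renaming (⊥ to ∅)
open import Data.Fin.Subset.Properties
open import Data.Integer using (ℤ; +_; +[1+_]; +≤+) renaming (_≤_ to _≤ℤ_)
open import Data.List using (List; []; _∷_; allFin; length; lookup; map; take)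
import Data.List.Membership.DecPropositional as ListMembership
open import Data.List.Membership.Propositional using () renaming (_∈_ to _∈ˡ_; _∉_ to _∉ˡ_)
open import Data.List.Membership.Propositional.Properties using (∈-map⁺; ∈-map⁻; ∈-lookup)
open import Data.List.Properties using (length-tabulate; map-tabulate)
open import Data.List.Relation.Binary.Permutation.Propositional using (_↭_; ↭-sym; ↭⇒↭ₛ)
open import Data.List.Relation.Binary.Permutation.Propositional.Properties using (∈-resp-↭; ↭-length)
import Data.List.Relation.Binary.Permutation.Setoid.Properties as ↭ₛ
open import Data.List.Relation.Unary.All as All using ([]; _∷_)
import Data.List.Relation.Unary.All.Properties as All
open import Data.List.Relation.Unary.AllPairs using ([]; _∷_)
open import Data.List.Relation.Unary.Any using (here; there)
open import Data.List.Relation.Unary.Unique.Propositional using (Unique)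
import Data.List.Relation.Unary.Unique.Propositional.Properties as Unique
open import Data.Nat using (ℕ; suc; s≤s; z≤n) renaming (_+_ to _+ℕ_; _≤_ to _≤ℕ_; _<_ to _<ℕ_)
import Data.Nat.Properties as ℕₚ
open import Data.Product using (_×_; _,_; proj₁; proj₂; ∃-syntax)
open import Data.Rational using (ℚ; 0ℚ; 1ℚ; ½; _+_; _*_; _/_; _≤_; _<_; 1/_; +-0-rawMonoid; positive; nonNegative; ≢-nonZero) renaming (_-_ to _−_; _≟_ to _≟ℚ_)
open import Data.Rational.Properties hiding (_≟_)
open import Data.Sum using (_⊎_; inj₁; inj₂; [_,_]′)
open import Data.Vec using ([]; _∷_)
import Data.Vec as Vec
open import Function using (_∘_; const; case_of_)
open import Relation.Binary.PropositionalEquality using (_≡_; _≢_; refl; sym; trans; cong; cong₂; subst; setoid; module ≡-Reasoning)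
open import Relation.Nullary using (Dec; yes; no; does; contradiction)
open import Relation.Nullary.Decidable using (True; dec-true; dec-false; dec⇒maybe; decidable-stable; toWitness; toWitnessFalse)
open import Tactic.RingSolver using (solve-∀)
open import Tactic.RingSolver.Core.AlmostCommutativeRing using (AlmostCommutativeRing; fromCommutativeRing)

-- Colour sets

∈-elements⁺ : ∀ {n} {p : Subset n} {x} → x ∈ p → x ∈ˡ elements p
∈-elements⁺ {p = inside  ∷ p} Vec.here       = here refl
∈-elements⁺ {p = inside  ∷ p} (Vec.there x∈) = there (∈-map⁺ suc (∈-elements⁺ x∈))
∈-elements⁺ {p = outside ∷ p} (Vec.there x∈) = ∈-map⁺ suc (∈-elements⁺ x∈)

∈-elements⁻ : ∀ {n} {p : Subset n} {x} → x ∈ˡ elements p → x ∈ p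
∈-elements⁻ {p = inside  ∷ p} (here refl) = Vec.here
∈-elements⁻ {p = inside  ∷ p} (there x∈) with ∈-map⁻ suc x∈
... | _ , y∈ , refl = Vec.there (∈-elements⁻ y∈)
∈-elements⁻ {p = outside ∷ p} x∈ with ∈-map⁻ suc x∈
... | _ , y∈ , refl = Vec.there (∈-elements⁻ y∈)

elements-unique : ∀ {n} (p : Subset n) → Unique (elements p)
elements-unique []            = []
elements-unique (inside  ∷ p) = All.map⁺ (All.universal (λ _ ()) (elements p)) ∷ Unique.map⁺ suc-injective (elements-unique p)
elements-unique (outside ∷ p) = Unique.map⁺ suc-injective (elements-unique p)

x∉p⇒∣p∣<n : ∀ {n} {p : Subset n} {x} → x ∉ p → ∣ p ∣ <ℕ n
x∉p⇒∣p∣<n {n} {p} {x} x∉p = subst (∣ p ∣ <ℕ_) (∣⊤∣≡n n) (p⊂q⇒∣p∣<∣q∣ {p = p} {⊤} (⊆⊤ , x , ∈⊤ , x∉p))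

x,y∉p⇒2+∣p∣≤n : ∀ {n} {p : Subset n} {x y} → x ∉ p → y ∉ p → x ≢ y → 2 +ℕ ∣ p ∣ ≤ℕ n
x,y∉p⇒2+∣p∣≤n {n} {p} {x} {y} x∉p y∉p x≢y = ℕₚ.≤-trans
  (s≤s (p⊂q⇒∣p∣<∣q∣ {p = p} {⊤ - y} ((λ z∈ → x∈p∧x≢y⇒x∈p-y ∈⊤ λ { refl → y∉p z∈ }) , x , x∈p∧x≢y⇒x∈p-y ∈⊤ x≢y , x∉p)))
  (x∉p⇒∣p∣<n (x∉p-x ⊤ y))

n≤∣p∣⇒p≡⊤ : ∀ {n} {p : Subset n} → n ≤ℕ ∣ p ∣ → p ≡ ⊤
n≤∣p∣⇒p≡⊤ {p = p} n≤ = ∣p∣≡n⇒p≡⊤ (ℕₚ.≤-antisym (∣p∣≤n p) n≤)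

two-elements : ∀ {n} {p : Subset n} → 2 ≤ℕ ∣ p ∣ → ∃[ x ] ∃[ y ] ∃[ r ] elements p ≡ x ∷ y ∷ r
two-elements {p = p} 2≤ with elements p | length-elements p
... | x ∷ y ∷ r | _ = x , y , r , refl
... | []        | e with () ← subst (2 ≤ℕ_) (sym e) 2≤
... | _ ∷ []    | e with s≤s () ← subst (2 ≤ℕ_) (sym e) 2≤

two-missing : ∀ {p : Subset 4} → ∣ p ∣ ≤ℕ 2 → ∃[ j ] ∃[ w ] j ≢ w × j ∉ p × w ∉ p
two-missing {p} ∣p∣≤2 with two-elements {p = ∁ p} (subst (2 ≤ℕ_) (sym (∣∁p∣≡n∸∣p∣ p)) (ℕₚ.∸-monoʳ-≤ 4 ∣p∣≤2))
... | j , w , r , e with elements-unique (∁ p) | (λ {x} → ∈-elements⁻ {p = ∁ p} {x})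
... | uniq | mem rewrite e with uniq
... | (j≢w ∷ _) ∷ _ = j , w , j≢w , x∈∁p⇒x∉p (mem (here refl)) , x∈∁p⇒x∉p (mem (there (here refl)))

∣p∣≤1+∣p-x∣ : ∀ {n} (p : Subset n) x → ∣ p ∣ ≤ℕ suc ∣ p - x ∣
∣p∣≤1+∣p-x∣ (inside  ∷ p) zero    = s≤s (ℕₚ.≤-reflexive (cong ∣_∣ (sym (p─⊥≡p p))))
∣p∣≤1+∣p-x∣ (outside ∷ p) zero    = ℕₚ.m≤n⇒m≤1+n (ℕₚ.≤-reflexive (cong ∣_∣ (sym (p─⊥≡p p))))
∣p∣≤1+∣p-x∣ (inside  ∷ p) (suc x) = s≤s (∣p∣≤1+∣p-x∣ p x)
∣p∣≤1+∣p-x∣ (outside ∷ p) (suc x) = ∣p∣≤1+∣p-x∣ p x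

one-missing : ∀ {p : Subset 4} {j} → 3 ≤ℕ ∣ p ∣ → j ∉ p → elements (∁ p) ≡ j ∷ []
one-missing {p} {j} 3≤p j∉p with elements (∁ p) | length-elements (∁ p) | ∈-elements⁺ (x∉p⇒x∈∁p j∉p)
... | w ∷ []    | _ | here refl = refl
... | _ ∷ _ ∷ _ | e | _ with s≤s () ← subst (_≤ℕ 1) (trans (sym (∣∁p∣≡n∸∣p∣ p)) (sym e)) (ℕₚ.∸-monoʳ-≤ 4 3≤p)

other-missing : ∀ {p : Subset 4} i → ∣ p ∣ ≤ℕ 2 → ∃[ j ] j ≢ i × j ∉ p
other-missing i ∣p∣≤2 with two-missing ∣p∣≤2
... | j , w , j≢w , j∉ , w∉ with j ≟ i
...   | no  j≢i  = j , j≢i , j∉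
...   | yes refl = w , j≢w ∘ sym , w∉

-- Deleting a vertex

lookup∉take : ∀ {A : Set} {xs : List A} → Unique xs → ∀ k → lookup xs k ∉ˡ take (toℕ k) xs
lookup∉take (x∉ ∷ _)    (suc k) (here e)   = All.lookup x∉ (∈-lookup k) (sym e)
lookup∉take (_ ∷ uniq)  (suc k) (there l∈) = lookup∉take uniq k l∈

take⊆ : ∀ {A : Set} k {xs : List A} {x} → x ∈ˡ take k xs → x ∈ˡ xs
take⊆ (suc k) {_ ∷ _} (here e)   = here e
take⊆ (suc k) {_ ∷ _} (there x∈) = there (take⊆ k x∈)

module _ {n : ℕ} where

  open ListMembership (_≟_ {n}) using () renaming (_∈?_ to _∈ˡ?_)

  prune-∈ : ∀ L (vs : List (Fin n)) k j {u} → u ∈ˡ take (toℕ k) vs → prune L vs k j u ≡ L u - j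
  prune-∈ L vs k j {u} u∈ rewrite dec-true (u ∈ˡ? take (toℕ k) vs) u∈ = refl

  prune-∉ : ∀ L (vs : List (Fin n)) k j {u} → u ∉ˡ take (toℕ k) vs → prune L vs k j u ≡ L u
  prune-∉ L vs k j {u} u∉ rewrite dec-false (u ∈ˡ? take (toℕ k) vs) u∉ = refl

  nbhd-∖⊆ : ∀ (G : Graph n) v {u w} → w ∈ nbhd (G ∖ v) u → w ∈ nbhd G u
  nbhd-∖⊆ G v {u} w∈ with u ≟ v
  ... | yes _ = contradiction w∈ ∉⊥
  ... | no  _ = p─q⊆p _ _ w∈

  deg-∖-≤ : ∀ (G : Graph n) v u → deg (G ∖ v) u ≤ℕ deg G u
  deg-∖-≤ G v u = p⊆q⇒∣p∣≤∣q∣ (nbhd-∖⊆ G v {u})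

  deg-∖-< : ∀ (G : Graph n) {v u} → u ∈ nbhd G v → deg (G ∖ v) u <ℕ deg G u
  deg-∖-< G {v} {u} u∈ with u ≟ v
  ... | yes refl = contradiction u∈ (loopless G)
  ... | no  _    = x∈p⇒∣p-x∣<∣p∣ (symmetric G u∈)

  -- The root-free part of reachability. It survives the deletion of any vertex, so it can be
  -- carried along when `v` and then `v₁` are removed.
  record Admissible (G : Graph n) (L : ListAssignment n) : Set where
    field
      deg≤3 : ∀ u → u ∈ V G → deg G u ≤ℕ 3
      lists : ∀ u → u ∈ V G → deg G u <ℕ ∣ L u ∣

  reachable⇒admissible : ∀ {G L v} → Reachable G L v → Admissible G L
  reachable⇒admissible {G} {L} R = record
    { deg≤3 = Reachable.deg≤3 R
    ; lists = λ u u∈ → subst (_≤ℕ ∣ L u ∣) (ℕₚ.+-comm (deg G u) 1) (Reachable.lists R u u∈)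
    }

  admissible-∖ : ∀ {G L} v → Admissible G L → Admissible (G ∖ v) L
  admissible-∖ {G} v A = record
    { deg≤3 = λ u u∈ → ℕₚ.≤-trans (deg-∖-≤ G v u) (A.deg≤3 u (p─q⊆p _ _ u∈))
    ; lists = λ u u∈ → ℕₚ.≤-trans (s≤s (deg-∖-≤ G v u)) (A.lists u (p─q⊆p _ _ u∈))
    }
    where module A = Admissible A

  module _ {G : Graph n} {v : Fin n} {vs : List (Fin n)} (vs↭ : vs ↭ neighbours G v) where

    ∈vs⇒∈nbhd : ∀ {u} → u ∈ˡ vs → u ∈ nbhd G v
    ∈vs⇒∈nbhd u∈ = ∈-elements⁻ (∈-resp-↭ vs↭ u∈)

    vs-unique : Unique vs
    vs-unique = ↭ₛ.Unique-resp-↭ (setoid (Fin n)) (↭⇒↭ₛ (↭-sym vs↭)) (elements-unique (nbhd G v))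

    length-vs : length vs ≡ deg G v
    length-vs = trans (↭-length vs↭) (length-elements (nbhd G v))

    -- Deleting `v` costs each neighbour one edge. The neighbour at position `k` keeps its whole
    -- list, since `vs` has no repetitions, and so gains the surplus required of a root. Each
    -- earlier neighbour loses at most one colour along with its edge.
    reachable-∖ : ∀ {L} → Admissible G L → ∀ k j → Reachable (G ∖ v) (prune L vs k j) (lookup vs k)
    reachable-∖ {L} A k j = record
      { v∈V    = x∈p∧x≢y⇒x∈p-y u∈V λ u≡v → loopless G (subst (_∈ nbhd G v) u≡v u∈)
      ; deg≤3  = Admissible.deg≤3 (admissible-∖ v A)
      ; lists  = lists′
      ; deg≤2  = ℕₚ.≤-pred (ℕₚ.≤-trans (deg-∖-< G u∈) (A.deg≤3 u u∈V))
      ; list-v = list-u (ℕₚ.≤-trans (s≤s (deg-∖-< G u∈)) (A.lists u u∈V))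
      }
      where
      module A = Admissible A
      u = lookup vs k

      u∈ : u ∈ nbhd G v
      u∈ = ∈vs⇒∈nbhd (∈-lookup k)

      u∈V : u ∈ V G
      u∈V = nbhd⊆V G u∈

      list-u : 2 +ℕ deg (G ∖ v) u ≤ℕ ∣ L u ∣ → deg (G ∖ v) u +ℕ 2 ≤ℕ ∣ prune L vs k j u ∣
      list-u le rewrite prune-∉ L vs k j (lookup∉take vs-unique k) | ℕₚ.+-comm (deg (G ∖ v) u) 2 = le

      lists′ : ∀ w → w ∈ V (G ∖ v) → deg (G ∖ v) w +ℕ 1 ≤ℕ ∣ prune L vs k j w ∣
      lists′ w w∈ rewrite ℕₚ.+-comm (deg (G ∖ v) w) 1 with w ∈ˡ? take (toℕ k) vs
      ... | yes w∈vs = ℕₚ.≤-pred (ℕₚ.≤-trans (s≤s (deg-∖-< G (∈vs⇒∈nbhd (take⊆ (toℕ k) w∈vs))))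
                         (ℕₚ.≤-trans (A.lists w (p─q⊆p _ _ w∈)) (∣p∣≤1+∣p-x∣ (L w) j)))
      ... | no  _    = Admissible.lists (admissible-∖ v A) w w∈

-- Rational arithmetic

ring : AlmostCommutativeRing _ _
ring = fromCommutativeRing +-*-commutativeRing λ x → dec⇒maybe (0ℚ ≟ℚ x)

infixr 7 _×ℚ_
-- Repeated addition unfolds in step with a sum over a list, as `∑-const` needs, and evaluates on
-- numerals.
_×ℚ_ : ℕ → ℚ → ℚ
_×ℚ_ = multiple +-0-rawMonoid

≤! : ∀ {p q} {_ : True (p ≤? q)} → p ≤ q
≤! {_} {_} {p≤q} = toWitness p≤q

-- The nonnegative certificate r reduces an inequality to a ring identity.
≤-by : ∀ {p q} r → 0ℚ ≤ r → q ≡ p + r → p ≤ q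
≤-by {p} r 0≤r refl = subst (_≤ p + r) (+-identityʳ p) (+-monoʳ-≤ p 0≤r)

0≤+ : ∀ {p q} → 0ℚ ≤ p → 0ℚ ≤ q → 0ℚ ≤ p + q
0≤+ = +-mono-≤

0≤* : ∀ {p q} → 0ℚ ≤ p → 0ℚ ≤ q → 0ℚ ≤ p * q
0≤* {p} {q} 0≤p 0≤q = nonNegative⁻¹ _ {{nonNeg*nonNeg⇒nonNeg p {{nonNegative 0≤p}} q {{nonNegative 0≤q}}}}

0≤- : ∀ {p q} → p ≤ q → 0ℚ ≤ q − p
0≤- {p} {q} p≤q = subst (_≤ q − p) (+-inverseʳ p) (+-monoˡ-≤ _ p≤q)

*-cancelʳ-≡ : ∀ {p q r} → 0ℚ < r → p * r ≡ q * r → p ≡ q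
*-cancelʳ-≡ {r = r} 0<r e =
  ≤-antisym (*-cancelʳ-≤-pos r (≤-reflexive e)) (*-cancelʳ-≤-pos r (≤-reflexive (sym e)))
  where instance _ = positive 0<r

p÷₀q*q≡p : ∀ {p q} → 0ℚ < q → (p ÷₀ q) * q ≡ p
p÷₀q*q≡p {p} {q} 0<q with q ≟ℚ 0ℚ
... | yes q≡0 = contradiction (sym q≡0) (<⇒≢ 0<q)
... | no  q≢0 = trans (*-assoc p (1/ q) q) (trans (cong (p *_) (*-inverseˡ q)) (*-identityʳ p))
  where instance _ = ≢-nonZero q≢0

÷₀-≤ : ∀ {p q c} → 0ℚ < q → p ≤ c * q → p ÷₀ q ≤ c
÷₀-≤ {p} {q} {c} 0<q h = *-cancelʳ-≤-pos q {{positive 0<q}} (subst (_≤ c * q) (sym (p÷₀q*q≡p 0<q)) h)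

÷₀-≥ : ∀ {p q c} → 0ℚ < q → c * q ≤ p → c ≤ p ÷₀ q
÷₀-≥ {p} {q} {c} 0<q h = *-cancelʳ-≤-pos q {{positive 0<q}} (subst (c * q ≤_) (sym (p÷₀q*q≡p 0<q)) h)

÷₀-≡ : ∀ {p q c} → 0ℚ < q → p ≡ c * q → p ÷₀ q ≡ c
÷₀-≡ 0<q e = *-cancelʳ-≡ 0<q (trans (p÷₀q*q≡p 0<q) e)

+-congˡ : ∀ r {p q} → p ≡ q → r + p ≡ r + q
+-congˡ r = cong λ z → r + z

∑-mono : ∀ {A : Set} {f g : A → ℚ} → (∀ j → f j ≤ g j) → ∀ xs → ∑ xs f ≤ ∑ xs g
∑-mono f≤g []       = ≤-refl
∑-mono f≤g (x ∷ xs) = +-mono-≤ (f≤g x) (∑-mono f≤g xs)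

∑-cong : ∀ {A : Set} {f g : A → ℚ} → (∀ j → f j ≡ g j) → ∀ xs → ∑ xs f ≡ ∑ xs g
∑-cong f≡g []       = refl
∑-cong f≡g (x ∷ xs) = cong₂ _+_ (f≡g x) (∑-cong f≡g xs)

∑-+ : ∀ {A : Set} (f g : A → ℚ) xs → ∑ xs (λ j → f j + g j) ≡ ∑ xs f + ∑ xs g
∑-+ f g []       = refl
∑-+ f g (x ∷ xs) = trans (+-congˡ (f x + g x) (∑-+ f g xs)) (interchange (f x) (g x) (∑ xs f) (∑ xs g))
  where
  interchange : ∀ a b c d → (a + b) + (c + d) ≡ (a + c) + (b + d)
  interchange = solve-∀ ring

∑-*ʳ : ∀ {A : Set} (f : A → ℚ) c xs → ∑ xs f * c ≡ ∑ xs (λ j → f j * c)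
∑-*ʳ f c []       = *-zeroˡ c
∑-*ʳ f c (x ∷ xs) = trans (*-distribʳ-+ c (f x) (∑ xs f)) (+-congˡ (f x * c) (∑-*ʳ f c xs))

∑-nonneg : ∀ {A : Set} {f : A → ℚ} → (∀ j → 0ℚ ≤ f j) → ∀ xs → 0ℚ ≤ ∑ xs f
∑-nonneg 0≤f []       = ≤-refl
∑-nonneg 0≤f (x ∷ xs) = 0≤+ (0≤f x) (∑-nonneg 0≤f xs)

∑-const : ∀ {A : Set} {c k} → 0ℚ ≤ c → (xs : List A) → k ≤ℕ length xs → k ×ℚ c ≤ ∑ xs (const c)
∑-const {k = 0}     0≤c xs       _        = ∑-nonneg (const 0≤c) xs
∑-const {c = c} {suc _} 0≤c (x ∷ xs) (s≤s k≤) = +-monoʳ-≤ c (∑-const 0≤c xs k≤)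

∑-map : ∀ {A B : Set} (h : A → B) (f : B → ℚ) xs → ∑ (map h xs) f ≡ ∑ xs (f ∘ h)
∑-map h f []       = refl
∑-map h f (x ∷ xs) = +-congˡ (f (h x)) (∑-map h f xs)

∑-allFin-suc : ∀ {n} (f : Fin (suc n) → ℚ) → ∑ (allFin (suc n)) f ≡ f zero + ∑ (allFin n) (f ∘ suc)
∑-allFin-suc {n} f = +-congˡ (f zero)
  (trans (cong (λ xs → ∑ xs f) (sym (map-tabulate {n = n} (λ j → j) suc))) (∑-map suc f (allFin n)))

restrict : ∀ {n} → Subset n → (Fin n → ℚ) → Fin n → ℚ
restrict p q j = if does (j ∈? p) then q j else 0ℚ

restrict-∈ : ∀ {n} {p : Subset n} {q j} → j ∈ p → restrict p q j ≡ q j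
restrict-∈ {p = p} {q} {j} j∈ rewrite dec-true (j ∈? p) j∈ = refl

-- Padding with zeros turns a sum over a list of colours into one of fixed length, to which the ring
-- solver applies.
∑-elements : ∀ {n} (p : Subset n) q → ∑ (elements p) q ≡ ∑ (allFin n) (restrict p q)
∑-elements []            q = refl
∑-elements (inside  ∷ p) q = trans (+-congˡ (q zero) (trans (∑-map suc q (elements p)) (∑-elements p (q ∘ suc))))
                                   (sym (∑-allFin-suc (restrict (inside ∷ p) q)))
∑-elements (outside ∷ p) q = trans (trans (∑-map suc q (elements p)) (∑-elements p (q ∘ suc)))
                               (trans (sym (+-identityˡ _)) (sym (∑-allFin-suc (restrict (outside ∷ p) q))))

∑-0 : ∀ {A : Set} (xs : List A) → ∑ xs (const 0ℚ) ≡ 0ℚ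
∑-0 []       = refl
∑-0 (x ∷ xs) = trans (+-identityˡ _) (∑-0 xs)

∑-single : ∀ {n} (i : Fin n) c → ∑ (allFin n) (λ j → if does (j ≟ i) then c else 0ℚ) ≡ c
∑-single {suc n} zero    c = trans (∑-allFin-suc {n} (λ j → if does (j ≟ zero) then c else 0ℚ))
  (trans (+-congˡ c (∑-0 (allFin n))) (+-identityʳ c))
∑-single {suc n} (suc i) c = trans (∑-allFin-suc {n} (λ j → if does (j ≟ suc i) then c else 0ℚ))
  (trans (+-identityˡ _) (∑-single i c))

-- The function equal to `r i` at `i`, to `c` on `p` and to 0 elsewhere lies below `r`; `i ∉ p`
-- keeps the two supports disjoint. It bounds both the normalising sum of the `f j` and the sum of
-- the `h j` from below.
∑-lower : ∀ {n} {r : Fin n → ℚ} {c} k i (p : Subset n) → (∀ j → 0ℚ ≤ r j) → 0ℚ ≤ c → i ∉ p →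
          k ≤ℕ ∣ p ∣ → (∀ j → j ∈ p → c ≤ r j) → r i + k ×ℚ c ≤ ∑ (allFin n) r
∑-lower {n} {r} {c} k i p 0≤r 0≤c i∉p k≤ c≤r = begin
  r i + k ×ℚ c                                        ≤⟨ +-monoʳ-≤ (r i) (∑-const 0≤c (elements p) (subst (k ≤ℕ_) (sym (length-elements p)) k≤)) ⟩
  r i + ∑ (elements p) (const c)                      ≡⟨ cong₂ _+_ (sym (∑-single i (r i))) (∑-elements p (const c)) ⟩
  ∑ (allFin n) δ + ∑ (allFin n) (restrict p (const c)) ≡⟨ ∑-+ δ (restrict p (const c)) (allFin n) ⟨
  ∑ (allFin n) (λ j → δ j + restrict p (const c) j)   ≤⟨ ∑-mono below (allFin n) ⟩
  ∑ (allFin n) r                                      ∎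
  where
  open ≤-Reasoning
  δ : Fin n → ℚ
  δ j = if does (j ≟ i) then r i else 0ℚ

  below : ∀ j → δ j + restrict p (const c) j ≤ r j
  below j with j ≟ i | j ∈? p
  ... | yes refl | yes i∈p = contradiction i∈p i∉p
  ... | yes refl | no  _   = ≤-reflexive (+-identityʳ (r i))
  ... | no  _    | yes j∈p = subst (_≤ r j) (sym (+-identityˡ c)) (c≤r j j∈p)
  ... | no  _    | no  _   = 0≤r j

∑-member : ∀ {n} {r : Fin n → ℚ} i → (∀ j → 0ℚ ≤ r j) → r i ≤ ∑ (allFin n) r
∑-member {n} {r} i 0≤r = subst (_≤ ∑ (allFin n) r) (+-identityʳ (r i))
  (∑-lower 0 i ∅ 0≤r ≤-refl ∉⊥ z≤n (λ _ j∈ → contradiction j∈ ∉⊥))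

-- The distribution `f` at the first neighbour

½^_ : ℕ → ℚ
½^ 0     = 1ℚ
½^ suc k = ½ * ½^ k

∏-bounds : ∀ {A : Set} {a : A → ℚ} → (∀ k → ½ ≤ a k) → (∀ k → a k ≤ 1ℚ) → ∀ xs →
           ½^ (length xs) ≤ ∏ xs a × ∏ xs a ≤ 1ℚ × 0ℚ ≤ ∏ xs a
∏-bounds ½≤a a≤1 []       = ≤-refl , ≤-refl , ≤!
∏-bounds {a = a} ½≤a a≤1 (x ∷ xs) with ∏-bounds ½≤a a≤1 xs
... | lo , hi , 0≤ =
  ≤-trans (*-monoˡ-≤-nonNeg ½ lo) (*-monoʳ-≤-nonNeg (∏ xs a) {{nonNegative 0≤}} (½≤a x)) ,
  ≤-trans (*-monoʳ-≤-nonNeg (∏ xs a) {{nonNegative 0≤}} (a≤1 x)) (subst (_≤ 1ℚ) (sym (*-identityˡ (∏ xs a))) hi) ,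
  0≤* (≤-trans ≤! (½≤a x)) 0≤

-- Used with `p` the list of `v₁`, `q` the products over the `d` remaining neighbours of `v₁`,
-- `m = d + 1` and `c` the `d`-th power of 1/2. As `d ≤ 2`, `c` is at least 1/4 and `m ×ℚ c` at
-- least 3/4, both with equality at `d = 2`.
module Normalised (p : Subset 4) (q : Colour → ℚ) (m : ℕ) (c : ℚ)
  (1/4≤c : + 1 / 4 ≤ c) (3/4≤mc : + 3 / 4 ≤ m ×ℚ c) (m<p : m <ℕ ∣ p ∣)
  (c≤q : ∀ w → c ≤ q w) (q≤1 : ∀ w → q w ≤ 1ℚ) where

  S : ℚ
  S = ∑ (elements p) q

  f : Colour → ℚ
  f j = if does (j ∈? p) then q j ÷₀ S else 0ℚ

  private
    r : Colour → ℚ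
    r = restrict p q

    0≤c : 0ℚ ≤ c
    0≤c = ≤-trans ≤! 1/4≤c

    0≤r : ∀ j → 0ℚ ≤ r j
    0≤r j with j ∈? p
    ... | yes _ = ≤-trans 0≤c (c≤q j)
    ... | no  _ = ≤!

    r≤1 : ∀ j → r j ≤ 1ℚ
    r≤1 j with j ∈? p
    ... | yes _ = q≤1 j
    ... | no  _ = ≤!

    S≡ : S ≡ ∑ (allFin 4) r
    S≡ = ∑-elements p q

    3/4≤S : + 3 / 4 ≤ S
    3/4≤S = ≤-trans 3/4≤mc (≤-trans
      (∑-const 0≤c (elements p) (subst (m ≤ℕ_) (sym (length-elements p)) (ℕₚ.<⇒≤ m<p)))
      (∑-mono c≤q (elements p)))

    0<S : 0ℚ < S
    0<S = <-≤-trans (toWitness {a? = 0ℚ <? + 3 / 4} _) 3/4≤S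

    f*S≡r : ∀ j → f j * S ≡ r j
    f*S≡r j with j ∈? p
    ... | yes _ = p÷₀q*q≡p 0<S
    ... | no  _ = *-zeroˡ S

    ≤-via-r : ∀ {j a} → r j ≤ a * S → f j ≤ a
    ≤-via-r {j} {a} h = *-cancelʳ-≤-pos S {{positive 0<S}} (subst (_≤ a * S) (sym (f*S≡r j)) h)

    ≥-via-r : ∀ {j a} → a * S ≤ r j → a ≤ f j
    ≥-via-r {j} {a} h = *-cancelʳ-≤-pos S {{positive 0<S}} (subst (a * S ≤_) (sym (f*S≡r j)) h)

    -- Besides `j`, at least `m` colours of `p` contribute `c` or more each.
    S-lower : ∀ {j} → j ∈ p → r j + m ×ℚ c ≤ S
    S-lower {j} j∈p = subst (r j + m ×ℚ c ≤_) (sym S≡)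
      (∑-lower m j (p - j) 0≤r 0≤c (x∉p-x p j) m≤ λ w w∈ → subst (c ≤_) (sym (restrict-∈ {q = q} (p─q⊆p _ _ w∈))) (c≤q w))
      where
      m≤ : m ≤ℕ ∣ p - j ∣
      m≤ = ℕₚ.≤-pred (ℕₚ.≤-trans m<p (∣p∣≤1+∣p-x∣ p j))

  f-∉ : ∀ {j} → j ∉ p → f j ≡ 0ℚ
  f-∉ {j} j∉ rewrite dec-false (j ∈? p) j∉ = refl

  0≤f : ∀ j → 0ℚ ≤ f j
  0≤f j = ≥-via-r (subst (_≤ r j) (sym (*-zeroˡ S)) (0≤r j))

  ∑f≡1 : ∑ (allFin 4) f ≡ 1ℚ
  ∑f≡1 = *-cancelʳ-≡ 0<S (begin
    ∑ (allFin 4) f * S             ≡⟨ ∑-*ʳ f S (allFin 4) ⟩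
    ∑ (allFin 4) (λ j → f j * S)   ≡⟨ ∑-cong f*S≡r (allFin 4) ⟩
    ∑ (allFin 4) r                 ≡⟨ S≡ ⟨
    S                              ≡⟨ *-identityˡ S ⟨
    1ℚ * S                         ∎)
    where open ≡-Reasoning

  private
    f-upper : ∀ {a j} → 0ℚ ≤ a → (j ∈ p → r j ≤ a * S) → f j ≤ a
    f-upper {a} {j} 0≤a r≤ = case j ∈? p of λ
      { (yes j∈) → ≤-via-r (r≤ j∈)
      ; (no  j∉) → subst (_≤ a) (sym (f-∉ j∉)) 0≤a
      }

  -- By `S-lower`, `f j` is at most t/(t + 3/4) with t = `q j`, which increases in t and equals 4/7
  -- at t = 1.
  f≤4/7 : ∀ j → f j ≤ + 4 / 7
  f≤4/7 j = f-upper ≤! λ j∈ → ≤-by _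
    (0≤+ (0≤* {+ 4 / 7} ≤! (0≤- (S-lower j∈))) (0≤+ (0≤* {+ 4 / 7} ≤! (0≤- 3/4≤mc)) (0≤* {+ 3 / 7} ≤! (0≤- (r≤1 j)))))
    (identity S (r j) (m ×ℚ c))
    where
    identity : ∀ S r k → + 4 / 7 * S ≡ r + (+ 4 / 7 * (S − (r + k)) + (+ 4 / 7 * (k − + 3 / 4) + + 3 / 7 * (1ℚ − r)))
    identity = solve-∀ ring

  -- The same estimate with 1 in place of 3/4, available when `v₁` has at most one remaining
  -- neighbour.
  f≤½ : 1ℚ ≤ m ×ℚ c → ∀ j → f j ≤ ½
  f≤½ 1≤mc j = f-upper ≤! λ j∈ → ≤-by _
    (0≤+ (0≤* {½} ≤! (0≤- (S-lower j∈))) (0≤+ (0≤* {½} ≤! (0≤- 1≤mc)) (0≤* {½} ≤! (0≤- (r≤1 j)))))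
    (identity S (r j) (m ×ℚ c))
    where
    identity : ∀ S r k → ½ * S ≡ r + (½ * (S − (r + k)) + (½ * (k − 1ℚ) + ½ * (1ℚ − r)))
    identity = solve-∀ ring

  -- At most three other colours contribute at most 1 each, so `f j` is at least t/(t + 3) with t =
  -- `q j` ≥ 1/4, and (1/4)/(13/4) = 1/13.
  f≥1/13 : ∀ {j} → j ∈ p → + 1 / 13 ≤ f j
  f≥1/13 {j} j∈ = ≥-via-r (subst (λ z → + 1 / 13 * z ≤ r j) (sym S≡) (≤-by _
    (0≤+ (0≤* {+ 12 / 13} ≤! (0≤- (≤-trans 1/4≤c (subst (c ≤_) (sym (restrict-∈ {q = q} j∈)) (c≤q j)))))
         (0≤* {+ 1 / 13} ≤! (0≤- (∑-member {r = λ w → 1ℚ − r w} j λ w → 0≤- (r≤1 w)))))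
    (identity (r j) (r 0F) (r 1F) (r 2F) (r 3F))))
    where
    identity : ∀ r r₀ r₁ r₂ r₃ → r ≡ + 1 / 13 * (r₀ + (r₁ + (r₂ + (r₃ + 0ℚ)))) +
      (+ 12 / 13 * (r − + 1 / 4) + + 1 / 13 * (((1ℚ − r₀) + ((1ℚ − r₁) + ((1ℚ − r₂) + ((1ℚ − r₃) + 0ℚ)))) − (1ℚ − r)))
    identity = solve-∀ ring

-- Estimates for the degree-two quotient

module Weights (f y : Colour → ℚ) (0≤f : ∀ j → 0ℚ ≤ f j) (f≤4/7 : ∀ j → f j ≤ + 4 / 7) (∑f≡1 : ∑ (allFin 4) f ≡ 1ℚ)
  (0≤y : ∀ j → 0ℚ ≤ y j) (y≤½ : ∀ j → y j ≤ ½) where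

  g h : Colour → ℚ
  g j = (1ℚ − f j) * (1ℚ − y j)
  h j = (1ℚ − f j) * (½ − y j)

  private
    0≤1-f : ∀ j → 0ℚ ≤ 1ℚ − f j
    0≤1-f j = 0≤- {f j} {1ℚ} (≤-trans (f≤4/7 j) ≤!)

    0≤h : ∀ j → 0ℚ ≤ h j
    0≤h j = 0≤* (0≤1-f j) (0≤- (y≤½ j))

    H : ℚ
    H = ∑ (allFin 4) h

    -- Replacing 1/2 by `c` shifts the sum by `c − ½` times the total of the `1ℚ − f j`, which is 4
    -- - 1 = 3. The case `c = 1ℚ` is the denominator; `c = + 6 / 13` serves `g÷∑g≤13/27-all`.
    ∑[1-f]*[c-y] : ∀ c → ∑ (allFin 4) (λ j → (1ℚ − f j) * (c − y j)) ≡ (c − ½) * (+ 3 / 1) + H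
    ∑[1-f]*[c-y] c = trans
      (identity c (f 0F) (f 1F) (f 2F) (f 3F) (y 0F) (y 1F) (y 2F) (y 3F))
      (cong (λ F → (c − ½) * (+ 4 / 1 − F) + H) ∑f≡1)
      where
      identity : ∀ c f₀ f₁ f₂ f₃ y₀ y₁ y₂ y₃ →
        (1ℚ − f₀) * (c − y₀) + ((1ℚ − f₁) * (c − y₁) + ((1ℚ − f₂) * (c − y₂) + ((1ℚ − f₃) * (c − y₃) + 0ℚ)))
        ≡ (c − ½) * (+ 4 / 1 − (f₀ + (f₁ + (f₂ + (f₃ + 0ℚ))))) +
          ((1ℚ − f₀) * (½ − y₀) + ((1ℚ − f₁) * (½ − y₁) + ((1ℚ − f₂) * (½ − y₂) + ((1ℚ − f₃) * (½ − y₃) + 0ℚ))))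
      identity = solve-∀ ring

    ∑g≡ : ∑ (allFin 4) g ≡ + 3 / 2 + H
    ∑g≡ = ∑[1-f]*[c-y] 1ℚ

    0<∑g : 0ℚ < ∑ (allFin 4) g
    0<∑g = subst (0ℚ <_) (sym ∑g≡)
      (<-≤-trans (toWitness {a? = 0ℚ <? + 3 / 2} _) (≤-by H (∑-nonneg 0≤h (allFin 4)) refl))

    0≤H-h : ∀ i → 0ℚ ≤ H − h i
    0≤H-h i = 0≤- (∑-member i 0≤h)

    ÷₀∑g-≤ : ∀ {i c} → g i ≤ c * (+ 3 / 2 + H) → g i ÷₀ ∑ (allFin 4) g ≤ c
    ÷₀∑g-≤ {i} {c} le = ÷₀-≤ 0<∑g (subst (λ z → g i ≤ c * z) (sym ∑g≡) le)

  -- The certificate vanishes only if `f i` and `y i` are 0 and `H` reduces to `h i`, the situation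
  -- of `g÷∑g≡½`.
  g÷∑g≤½ : ∀ i → g i ÷₀ ∑ (allFin 4) g ≤ ½
  g÷∑g≤½ i = ÷₀∑g-≤ {i} (≤-by _
    (0≤+ (0≤* {½} ≤! (0≤H-h i)) (0≤+ (0≤* {+ 3 / 4} ≤! (0≤f i)) (0≤* {½} ≤! (0≤* (0≤1-f i) (0≤y i)))))
    (identity (f i) (y i) H))
    where
    identity : ∀ f y H → ½ * (+ 3 / 2 + H) ≡ (1ℚ − f) * (1ℚ − y) +
      (½ * (H − (1ℚ − f) * (½ − y)) + (+ 3 / 4 * f + ½ * ((1ℚ − f) * y)))
    identity = solve-∀ ring

  -- The numerator is at least 3/7 · 1/2 = 3/14, and the denominator is at most the sum of the
  -- `1ℚ − f j`, which is 3.
  g÷∑g≥1/14 : ∀ i → + 1 / 14 ≤ g i ÷₀ ∑ (allFin 4) g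
  g÷∑g≥1/14 i = ÷₀-≥ 0<∑g (≤-trans (*-monoˡ-≤-nonNeg (+ 1 / 14) ∑g≤3) (≤-by _
    (0≤+ (0≤* (0≤- (f≤4/7 i)) (0≤- (y≤½ i))) (0≤+ (0≤* {½} ≤! (0≤- (f≤4/7 i))) (0≤* {+ 3 / 7} ≤! (0≤- (y≤½ i)))))
    (identity (f i) (y i))))
    where
    identity : ∀ f y → (1ℚ − f) * (1ℚ − y) ≡ + 3 / 14 + ((+ 4 / 7 − f) * (½ − y) + (½ * (+ 4 / 7 − f) + + 3 / 7 * (½ − y)))
    identity = solve-∀ ring

    identity₄ : ∀ f₀ f₁ f₂ f₃ → (1ℚ − f₀) + ((1ℚ − f₁) + ((1ℚ − f₂) + ((1ℚ − f₃) + 0ℚ))) ≡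
      + 4 / 1 − (f₀ + (f₁ + (f₂ + (f₃ + 0ℚ))))
    identity₄ = solve-∀ ring

    identity₁ : ∀ f y → 1ℚ − f ≡ (1ℚ − f) * (1ℚ − y) + (1ℚ − f) * y
    identity₁ = solve-∀ ring

    ∑g≤3 : ∑ (allFin 4) g ≤ + 3 / 1
    ∑g≤3 = ≤-trans
      (∑-mono {f = g} {λ j → 1ℚ − f j} (λ j → ≤-by _ (0≤* (0≤1-f j) (0≤y j)) (identity₁ (f j) (y j))) (allFin 4))
      (≤-reflexive (trans (identity₄ (f 0F) (f 1F) (f 2F) (f 3F)) (cong (λ F → + 4 / 1 − F) ∑f≡1)))

  g÷∑g≤13/27-f : ∀ {i} → + 1 / 13 ≤ f i → g i ÷₀ ∑ (allFin 4) g ≤ + 13 / 27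
  g÷∑g≤13/27-f {i} 1/13≤f = ÷₀∑g-≤ {i} (≤-by _
    -- The constant 15/702 is the slack left at `f i` = 1/13, `y i` = 0 and `H` = `h i`.
    (0≤+ (0≤* {+ 13 / 27} ≤! (0≤H-h i)) (0≤+ {+ 15 / 702} ≤!
      (0≤+ (0≤* {+ 41 / 54} ≤! (0≤- 1/13≤f)) (0≤* {+ 14 / 27} ≤! (0≤* (0≤1-f i) (0≤y i))))))
    (identity (f i) (y i) H))
    where
    identity : ∀ f y H → + 13 / 27 * (+ 3 / 2 + H) ≡ (1ℚ − f) * (1ℚ − y) +
      (+ 13 / 27 * (H − (1ℚ − f) * (½ − y)) + (+ 15 / 702 + (+ 41 / 54 * (f − + 1 / 13) + + 14 / 27 * ((1ℚ − f) * y))))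
    identity = solve-∀ ring

  -- This is the source of 13/27: at `f i` = 0, `y i` = 1/14 and `H` = `h i` = 3/7 the quotient is
  -- (13/14)/(27/14).
  g÷∑g≤13/27-y : ∀ {i} → + 1 / 14 ≤ y i → g i ÷₀ ∑ (allFin 4) g ≤ + 13 / 27
  g÷∑g≤13/27-y {i} 1/14≤y = ÷₀∑g-≤ {i} (≤-by _
    (0≤+ (0≤* {+ 13 / 27} ≤! (0≤H-h i))
      (0≤+ (0≤* {+ 13 / 18} ≤! (0≤f i)) (0≤* {+ 14 / 27} ≤! (0≤* (0≤1-f i) (0≤- 1/14≤y)))))
    (identity (f i) (y i) H))
    where
    identity : ∀ f y H → + 13 / 27 * (+ 3 / 2 + H) ≡ (1ℚ − f) * (1ℚ − y) +
      (+ 13 / 27 * (H − (1ℚ − f) * (½ − y)) + (+ 13 / 18 * f + + 14 / 27 * ((1ℚ − f) * (y − + 1 / 14))))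
    identity = solve-∀ ring

  private
    -- The numerator is at most 1, and 3/2 + 15/26 = 27/13.
    g÷∑g≤13/27-H : ∀ {i} → + 15 / 26 ≤ H → g i ÷₀ ∑ (allFin 4) g ≤ + 13 / 27
    g÷∑g≤13/27-H {i} 15/26≤H = ÷₀∑g-≤ {i} (≤-by _
      (0≤+ (0≤* {+ 13 / 27} ≤! (0≤- 15/26≤H)) (0≤+ (0≤f i) (0≤* (0≤1-f i) (0≤y i))))
      (identity (f i) (y i) H))
      where
      identity : ∀ f y H → + 13 / 27 * (+ 3 / 2 + H) ≡ (1ℚ − f) * (1ℚ − y) +
        (+ 13 / 27 * (H − + 15 / 26) + (f + (1ℚ − f) * y))
      identity = solve-∀ ring

  module _ {i : Colour} (fᵢ≡0 : f i ≡ 0ℚ) (yᵢ≡0 : y i ≡ 0ℚ) where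

    -- With 6/13 in place of 1/2 all summands stay nonnegative and the sum drops by only 3/26. The
    -- summand at `i` is 6/13, so `H` is at least 6/13 + 3/26, which is exactly 15/26.
    g÷∑g≤13/27-all : (∀ j → j ≢ i → y j ≤ + 6 / 13) → g i ÷₀ ∑ (allFin 4) g ≤ + 13 / 27
    g÷∑g≤13/27-all y≤ = g÷∑g≤13/27-H {i} (≤-by _ (0≤- kᵢ≤K) (identity H))
      where
      k : Colour → ℚ
      k j = (1ℚ − f j) * (+ 6 / 13 − y j)

      0≤k : ∀ j → 0ℚ ≤ k j
      0≤k j with j ≟ i
      ... | yes refl = 0≤* (0≤1-f i) (0≤- (subst (_≤ + 6 / 13) (sym yᵢ≡0) ≤!))
      ... | no  j≢i  = 0≤* (0≤1-f j) (0≤- (y≤ j j≢i))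

      kᵢ≤K : + 6 / 13 ≤ (+ 6 / 13 − ½) * (+ 3 / 1) + H
      kᵢ≤K = subst (_≤ (+ 6 / 13 − ½) * (+ 3 / 1) + H) (cong₂ (λ a b → (1ℚ − a) * (+ 6 / 13 − b)) fᵢ≡0 yᵢ≡0)
        (≤-trans (∑-member i 0≤k) (≤-reflexive (∑[1-f]*[c-y] (+ 6 / 13))))

      identity : ∀ H → H ≡ + 15 / 26 + (((+ 6 / 13 − ½) * (+ 3 / 1) + H) − + 6 / 13)
      identity = solve-∀ ring

    private
      hᵢ≡½ : h i ≡ ½
      hᵢ≡½ = cong₂ (λ a b → (1ℚ − a) * (½ − b)) fᵢ≡0 yᵢ≡0

    -- Here `h i` is 1/2 and `k` further colours add at least `½ * (½ − b)` each, in total 1/12 or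
    -- more; 7/12 exceeds 15/26. Both uses, one colour with `b` = 1/3 and two colours with `b` =
    -- 5/12, give exactly 1/12.
    g÷∑g≤13/27-some : (∀ j → f j ≤ ½) → ∀ k (p : Subset 4) b {_ : True (b ≤? ½)} {_ : True (+ 1 / 12 ≤? k ×ℚ (½ * (½ − b)))} →
      i ∉ p → k ≤ℕ ∣ p ∣ → (∀ j → j ∈ p → y j ≤ b) → g i ÷₀ ∑ (allFin 4) g ≤ + 13 / 27
    g÷∑g≤13/27-some f≤½ k p b {b≤½} {1/12≤} i∉p k≤p y≤b = g÷∑g≤13/27-H {i} (≤-trans {j = ½ + + 1 / 12} ≤! (≤-trans
      (subst (λ z → ½ + + 1 / 12 ≤ z + k ×ℚ c) (sym hᵢ≡½) (+-monoʳ-≤ ½ (toWitness 1/12≤)))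
      (∑-lower k i p 0≤h (0≤* {½} ≤! (0≤- (toWitness b≤½))) i∉p k≤p λ j j∈ →
        ≤-by _ (0≤+ (0≤* {½} ≤! (0≤- (y≤b j j∈))) (0≤* (0≤- (f≤½ j)) (0≤- (y≤½ j)))) (identity (f j) (y j) b))))
      where
      c : ℚ
      c = ½ * (½ − b)
      identity : ∀ f y b → (1ℚ − f) * (½ − y) ≡ ½ * (½ − b) + (½ * (b − y) + (½ − f) * (½ − y))
      identity = solve-∀ ring

    -- Every `h j` with `j ≢ i` vanishes whatever `f j` is, so the denominator is 3/2 + 1/2 while
    -- the numerator is 1.
    g÷∑g≡½ : (∀ j → j ≢ i → y j ≡ ½) → g i ÷₀ ∑ (allFin 4) g ≡ ½
    g÷∑g≡½ y≡½ = ÷₀-≡ 0<∑g (trans (cong₂ (λ a b → (1ℚ − a) * (1ℚ − b)) fᵢ≡0 yᵢ≡0)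
      (cong (½ *_) (sym (trans ∑g≡ (cong (λ z → + 3 / 2 + z) H≡½)))))
      where
      h≡ : ∀ j → h j ≡ (if does (j ≟ i) then ½ else 0ℚ)
      h≡ j with j ≟ i
      ... | yes refl = hᵢ≡½
      ... | no  j≢i  = trans (cong (λ z → (1ℚ − f j) * (½ − z)) (y≡½ j j≢i)) (*-zeroʳ (1ℚ − f j))

      H≡½ : H ≡ ½
      H≡½ = trans (∑-cong h≡ (allFin 4)) (∑-single i ½)

-- Estimates for the degree-one quotients

module _ {x : ℚ} (0≤x : 0ℚ ≤ x) where

  [1-x]÷3≤1/3 : (1ℚ − x) ÷₀ (+ 3 / 1) ≤ + 1 / 3
  [1-x]÷3≤1/3 = ÷₀-≤ {1ℚ − x} (toWitness {a? = 0ℚ <? + 3 / 1} _) (≤-by x 0≤x (identity x))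
    where
    identity : ∀ x → 1ℚ ≡ (1ℚ − x) + x
    identity = solve-∀ ring

  -- Equality at `x` = 1/2: this is where the leaf bound 1/6 comes from.
  [1-x]÷3≥1/6 : x ≤ ½ → + 1 / 6 ≤ (1ℚ − x) ÷₀ (+ 3 / 1)
  [1-x]÷3≥1/6 x≤½ = ÷₀-≥ (toWitness {a? = 0ℚ <? + 3 / 1} _) (≤-by _ (0≤- x≤½) (identity x))
    where
    identity : ∀ x → 1ℚ − x ≡ ½ + (½ − x)
    identity = solve-∀ ring

  module _ {y : ℚ} (0≤y : 0ℚ ≤ y) where
    private
      0<2+y : 0ℚ < + 2 / 1 + y
      0<2+y = <-≤-trans (toWitness {a? = 0ℚ <? + 2 / 1} _) (≤-by y 0≤y refl)

    [1-x]÷[2+y]≤½ : (1ℚ − x) ÷₀ (+ 2 / 1 + y) ≤ ½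
    [1-x]÷[2+y]≤½ = ÷₀-≤ 0<2+y (≤-by _ (0≤+ 0≤x (0≤* {½} ≤! 0≤y)) (identity x y))
      where
      identity : ∀ x y → ½ * (+ 2 / 1 + y) ≡ (1ℚ − x) + (x + ½ * y)
      identity = solve-∀ ring

    [1-x]÷[2+y]≥1/6 : x ≤ ½ → y ≤ ½ → + 1 / 6 ≤ (1ℚ − x) ÷₀ (+ 2 / 1 + y)
    [1-x]÷[2+y]≥1/6 x≤½ y≤½ = ÷₀-≥ 0<2+y (≤-by _
      (0≤+ (0≤- x≤½) (0≤+ {+ 1 / 12} ≤! (0≤* {+ 1 / 6} ≤! (0≤- y≤½)))) (identity x y))
      where
      identity : ∀ x y → 1ℚ − x ≡ + 1 / 6 * (+ 2 / 1 + y) + ((½ − x) + (+ 1 / 12 + + 1 / 6 * (½ − y)))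
      identity = solve-∀ ring

    [1-x]÷[2+y]≤5/12 : + 1 / 6 ≤ x → (1ℚ − x) ÷₀ (+ 2 / 1 + y) ≤ + 5 / 12
    [1-x]÷[2+y]≤5/12 1/6≤x = ÷₀-≤ 0<2+y (≤-by _ (0≤+ (0≤- 1/6≤x) (0≤* {+ 5 / 12} ≤! 0≤y)) (identity x y))
      where
      identity : ∀ x y → + 5 / 12 * (+ 2 / 1 + y) ≡ (1ℚ − x) + ((x − + 1 / 6) + + 5 / 12 * y)
      identity = solve-∀ ring

    -- Equality at `x` = 0, `y` = 1/6: this is where the constant 6/13 comes from.
    [1-x]÷[2+y]≤6/13-y : + 1 / 6 ≤ y → (1ℚ − x) ÷₀ (+ 2 / 1 + y) ≤ + 6 / 13
    [1-x]÷[2+y]≤6/13-y 1/6≤y = ÷₀-≤ 0<2+y (≤-by _ (0≤+ 0≤x (0≤* {+ 6 / 13} ≤! (0≤- 1/6≤y))) (identity x y))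
      where
      identity : ∀ x y → + 6 / 13 * (+ 2 / 1 + y) ≡ (1ℚ − x) + (x + + 6 / 13 * (y − + 1 / 6))
      identity = solve-∀ ring

    [1-x]÷[2+y]≤6/13-xy : + 1 / 14 ≤ x → + 1 / 14 ≤ y → (1ℚ − x) ÷₀ (+ 2 / 1 + y) ≤ + 6 / 13
    [1-x]÷[2+y]≤6/13-xy 1/14≤x 1/14≤y = ÷₀-≤ 0<2+y (≤-by _
      -- The constant 5/182 is the slack left at `x` = `y` = 1/14.
      (0≤+ {+ 5 / 182} ≤! (0≤+ (0≤- 1/14≤x) (0≤* {+ 6 / 13} ≤! (0≤- 1/14≤y)))) (identity x y))
      where
      identity : ∀ x y → + 6 / 13 * (+ 2 / 1 + y) ≡ (1ℚ − x) + (+ 5 / 182 + ((x − + 1 / 14) + + 6 / 13 * (y − + 1 / 14)))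
      identity = solve-∀ ring

1-x-bounds : ∀ {x} → 0ℚ ≤ x → x ≤ ½ → ½ ≤ 1ℚ − x × 1ℚ − x ≤ 1ℚ
1-x-bounds {x} 0≤x x≤½ = ≤-by _ (0≤- x≤½) (identity₁ x) , ≤-by x 0≤x (identity₂ x)
  where
  identity₁ : ∀ x → 1ℚ − x ≡ ½ + (½ − x)
  identity₁ = solve-∀ ring
  identity₂ : ∀ x → 1ℚ ≡ (1ℚ − x) + x
  identity₂ = solve-∀ ring

½^-bounds : ∀ {d} → d ≤ℕ 2 → + 1 / 4 ≤ ½^ d × + 3 / 4 ≤ suc d ×ℚ ½^ d
½^-bounds {0} _ = ≤! , ≤!
½^-bounds {1} _ = ≤! , ≤!
½^-bounds {2} _ = ≤! , ≤!
½^-bounds {suc (suc (suc _))} (s≤s (s≤s ()))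

½^-bound₁ : ∀ {d} → d ≤ℕ 1 → 1ℚ ≤ suc d ×ℚ ½^ d
½^-bound₁ {0} _ = ≤!
½^-bound₁ {1} _ = ≤!
½^-bound₁ {suc (suc _)} (s≤s ())

reciprocal-bounds : ∀ {p} → 2 ≤ℕ ∣ p ∣ → + 1 / 6 ≤ reciprocal-size p × reciprocal-size p ≤ ½
reciprocal-bounds {p} 2≤p with ∣ p ∣ | ∣p∣≤n p
... | 1 | _ = contradiction 2≤p (λ { (s≤s ()) })
... | 2 | _ = ≤! , ≤!
... | 3 | _ = ≤! , ≤!
... | 4 | _ = ≤! , ≤!
... | suc (suc (suc (suc (suc _)))) | s≤s (s≤s (s≤s (s≤s ())))

reciprocal≤1/3 : ∀ {p} → 3 ≤ℕ ∣ p ∣ → reciprocal-size p ≤ + 1 / 3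
reciprocal≤1/3 {p} 3≤p with ∣ p ∣ | ∣p∣≤n p
... | 1 | _ = contradiction 3≤p (λ { (s≤s ()) })
... | 2 | _ = contradiction 3≤p (λ { (s≤s (s≤s ())) })
... | 3 | _ = ≤!
... | 4 | _ = ≤!
... | suc (suc (suc (suc (suc _)))) | s≤s (s≤s (s≤s (s≤s ())))

reciprocal≡½ : ∀ {p} → ∣ p ∣ ≡ 2 → reciprocal-size p ≡ ½
reciprocal≡½ e rewrite e = refl

-- The invariant of the recursion

module _ {n : ℕ} where

  list≥deg+2 : ∀ {G : Graph n} {L v} → Reachable G L v → 2 +ℕ deg G v ≤ℕ ∣ L v ∣
  list≥deg+2 {G} {L} {v} R = subst (_≤ℕ ∣ L v ∣) (ℕₚ.+-comm (deg G v) 2) (Reachable.list-v R)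

  -- A list missing a colour has at most three, and reachability puts two more colours than the
  -- degree in the list of the root. This is what makes `lower-leaf` applicable.
  missing⇒deg≤1 : ∀ {G : Graph n} {L v} → Reachable G L v → ∀ {j} → j ∉ L v → deg G v ≤ℕ 1
  missing⇒deg≤1 R j∉ = ℕₚ.+-cancelˡ-≤ 2 _ 1 (ℕₚ.≤-trans (list≥deg+2 R) (ℕₚ.≤-pred (x∉p⇒∣p∣<n j∉)))

  record Bounds (G : Graph n) (L : ListAssignment n) (v : Fin n) (i : Colour) (x : ℚ) : Set where
    field
      absent     : i ∉ L v → x ≡ 0ℚ
      ≤½         : x ≤ ½
      lower      : i ∈ L v → + 1 / 14 ≤ x
      lower-leaf : i ∈ L v → deg G v ≤ℕ 1 → + 1 / 6 ≤ x

    0≤ : 0ℚ ≤ x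
    0≤ with i ∈? L v
    ... | yes i∈ = ≤-trans ≤! (lower i∈)
    ... | no  i∉ = ≤-reflexive (sym (absent i∉))

-- The procedure

module Analysis {n : ℕ} (O : Orders n) where
  open Orders O
  open Procedure O

  Bounded : Oracle → Set
  Bounded rec = ∀ {G L v} → Reachable G L v → ∀ i → Bounds G L v i (rec G L v i)

  next : Oracle → Oracle
  next rec G L v i = Step.value rec G L v i

  base-bounded : Bounded base
  base-bounded {G} {L} {v} R i with i ∈? L v | reciprocal-bounds {L v} (ℕₚ.≤-trans (ℕₚ.m≤m+n 2 _) (list≥deg+2 R))
  ... | no  i∉ | _       = record { absent = λ _ → refl ; ≤½ = ≤! ; lower = λ i∈ → contradiction i∈ i∉ ; lower-leaf = λ i∈ → contradiction i∈ i∉ }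
  ... | yes i∈ | lo , hi = record { absent = λ i∉ → contradiction i∈ i∉ ; ≤½ = hi ; lower = λ _ → ≤-trans ≤! lo ; lower-leaf = λ _ _ → lo }

  module _ {G : Graph n} {L : ListAssignment n} {v : Fin n} {i : Colour} where

    next-∉ : ∀ rec → i ∉ L v → next rec G L v i ≡ 0ℚ
    next-∉ rec i∉ rewrite dec-false (i ∈? L v) i∉ = refl

    next-∈ : ∀ rec → i ∈ L v → next rec G L v i ≡ Step.by-degree rec G L v i (nbrs G v)
    next-∈ rec i∈ rewrite dec-true (i ∈? L v) i∈ = refl

  length-nbrs : ∀ G v → length (nbrs G v) ≡ deg G v
  length-nbrs G v = length-vs {G = G} {v} (nbrs-↭ G v)

  -- Vertices of degree one

  module Leaf {G : Graph n} {L : ListAssignment n} {v u : Fin n}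
    (R : Reachable G L v) (nbrs≡ : nbrs G v ≡ u ∷ []) where

    u↭ : u ∷ [] ↭ neighbours G v
    u↭ = subst (_↭ neighbours G v) nbrs≡ (nbrs-↭ G v)

    deg≡1 : deg G v ≡ 1
    deg≡1 = sym (length-vs {G = G} {v} u↭)

    u∈nbhd : u ∈ nbhd G v
    u∈nbhd = ∈vs⇒∈nbhd {G = G} {v} u↭ (here refl)

    Rᵤ : Reachable (G ∖ v) L u
    -- At position 0 nothing is pruned, so the pruned assignment reduces to `L` and the choice of
    -- colour is immaterial.
    Rᵤ = reachable-∖ {G = G} {v} u↭ (reachable⇒admissible R) 0F 0F

    3≤list : 3 ≤ℕ ∣ L v ∣
    3≤list = subst (λ d → 2 +ℕ d ≤ℕ ∣ L v ∣) deg≡1 (list≥deg+2 R)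

    full-or-missing : L v ≡ ⊤ ⊎ ∃[ j ] j ∉ L v
    full-or-missing with elements (∁ (L v)) in e
    ... | []    = inj₁ (n≤∣p∣⇒p≡⊤ (ℕₚ.m∸n≡0⇒m≤n (trans (sym (∣∁p∣≡n∸∣p∣ (L v))) (trans (sym (length-elements (∁ (L v)))) (cong length e)))))
    ... | j ∷ _ = inj₂ (j , x∈∁p⇒x∉p (∈-elements⁻ (subst (j ∈ˡ_) (sym e) (here refl))))

    module _ {i : Colour} (i∈ : i ∈ L v) where

      -- Since the list of `v` has at least three colours, the two-colour clause of `deg-1` never
      -- fires.
      two-others : ∃[ a ] ∃[ b ] ∃[ r ] elements (L v - i) ≡ a ∷ b ∷ r
      two-others = two-elements {p = L v - i} (ℕₚ.≤-pred (ℕₚ.≤-trans 3≤list (∣p∣≤1+∣p-x∣ (L v) i)))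

      next-full : L v ≡ ⊤ → ∀ rec → next rec G L v i ≡ (1ℚ − rec (G ∖ v) L u i) ÷₀ (+ 3 / 1)
      next-full full rec with two-others
      ... | a , b , r , e = trans (next-∈ rec i∈) lemma
        where
        lemma : Step.by-degree rec G L v i (nbrs G v) ≡ (1ℚ − rec (G ∖ v) L u i) ÷₀ (+ 3 / 1)
        lemma rewrite nbrs≡ | e | cong (elements ∘ ∁) full = refl

      next-missing : ∀ {j} → j ∉ L v → ∀ rec →
        next rec G L v i ≡ (1ℚ − rec (G ∖ v) L u i) ÷₀ (+ 2 / 1 + rec (G ∖ v) L u j)
      next-missing {j} j∉ rec with two-others
      ... | a , b , r , e = trans (next-∈ rec i∈) lemma
        where
        lemma : Step.by-degree rec G L v i (nbrs G v) ≡ (1ℚ − rec (G ∖ v) L u i) ÷₀ (+ 2 / 1 + rec (G ∖ v) L u j)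
        lemma rewrite nbrs≡ | e | one-missing 3≤list j∉ = refl

      module Missing {j} (j∉ : j ∉ L v) {rec} (bounded : Bounded rec) where
        module X = Bounds (bounded Rᵤ i)
        module Y = Bounds (bounded Rᵤ j)

        next≡½ : i ∉ L u → j ∉ L u → next rec G L v i ≡ ½
        next≡½ i∉u j∉u = trans (next-missing j∉ rec)
          (cong₂ (λ x y → (1ℚ − x) ÷₀ (+ 2 / 1 + y)) (X.absent i∉u) (Y.absent j∉u))

        next≤5/12 : i ∈ L u → j ∉ L u → next rec G L v i ≤ + 5 / 12
        next≤5/12 i∈u j∉u = subst (_≤ + 5 / 12) (sym (next-missing j∉ rec))
          ([1-x]÷[2+y]≤5/12 X.0≤ Y.0≤ (X.lower-leaf i∈u (missing⇒deg≤1 Rᵤ j∉u)))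

        -- If exactly one of the two colours lies in `L u`, the absence of the other makes `u` a
        -- vertex of degree at most 1, so the present one has probability at least 1/6. If both lie
        -- in it, 1/14 for each suffices.
        next≤6/13 : i ∈ L u ⊎ j ∈ L u → next rec G L v i ≤ + 6 / 13
        next≤6/13 _ with i ∈? L u | j ∈? L u
        next≤6/13 _ | yes i∈u | no  j∉u = ≤-trans (next≤5/12 i∈u j∉u) ≤!
        next≤6/13 _ | no  i∉u | yes j∈u = subst (_≤ + 6 / 13) (sym (next-missing j∉ rec))
          ([1-x]÷[2+y]≤6/13-y X.0≤ Y.0≤ (Y.lower-leaf j∈u (missing⇒deg≤1 Rᵤ i∉u)))
        next≤6/13 _ | yes i∈u | yes j∈u = subst (_≤ + 6 / 13) (sym (next-missing j∉ rec))
          ([1-x]÷[2+y]≤6/13-xy X.0≤ Y.0≤ (X.lower i∈u) (Y.lower j∈u))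
        next≤6/13 (inj₁ i∈u) | no i∉u | no _   = contradiction i∈u i∉u
        next≤6/13 (inj₂ j∈u) | no _   | no j∉u = contradiction j∈u j∉u

      next-range : ∀ {rec} → Bounded rec → + 1 / 6 ≤ next rec G L v i × next rec G L v i ≤ ½
      next-range {rec} bounded with full-or-missing
      ... | inj₁ full = subst (λ z → + 1 / 6 ≤ z × z ≤ ½) (sym (next-full full rec))
        ([1-x]÷3≥1/6 X.0≤ X.≤½ , ≤-trans ([1-x]÷3≤1/3 X.0≤) ≤!)
        where module X = Bounds (bounded Rᵤ i)
      ... | inj₂ (j , j∉) = subst (λ z → + 1 / 6 ≤ z × z ≤ ½) (sym (next-missing j∉ rec))
        ([1-x]÷[2+y]≥1/6 X.0≤ Y.0≤ X.≤½ Y.≤½ , [1-x]÷[2+y]≤½ X.0≤ Y.0≤)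
        where open Missing j∉ bounded

  -- Vertices of degree two

  module Fork {G : Graph n} {L : ListAssignment n} {v v₁ v₂ : Fin n}
    (A : Admissible G L) (σ : v₁ ∷ v₂ ∷ [] ↭ neighbours G v) where

    R₁ : Reachable (G ∖ v) L v₁
    R₁ = reachable-∖ {G = G} {v} σ A 0F 0F

    L₂ : Colour → ListAssignment n
    L₂ = prune L (v₁ ∷ v₂ ∷ []) 1F

    R₂ : ∀ j → Reachable (G ∖ v) (L₂ j) v₂
    R₂ = reachable-∖ {G = G} {v} σ A 1F

    v₁≢v₂ : v₁ ≢ v₂
    v₁≢v₂ with (v₁≢v₂ ∷ _) ∷ _ ← vs-unique {G = G} {v} σ = v₁≢v₂

    us : List (Fin n)
    us = nbrs (G ∖ v) v₁

    d : ℕ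
    d = deg (G ∖ v) v₁

    L₂≡L : ∀ j {u} → u ≢ v₁ → L₂ j u ≡ L u
    L₂≡L j u≢v₁ = prune-∉ L (v₁ ∷ v₂ ∷ []) 1F j λ { (here u≡v₁) → u≢v₁ u≡v₁ ; (there ()) }

    L₂v₁≡ : ∀ j → L₂ j v₁ ≡ L v₁ - j
    L₂v₁≡ j = prune-∈ L (v₁ ∷ v₂ ∷ []) 1F j (here refl)

    L₂v₂≡ : ∀ j → L₂ j v₂ ≡ L v₂
    L₂v₂≡ j = L₂≡L j (v₁≢v₂ ∘ sym)

    module Evaluation {rec : Oracle} (bounded : Bounded rec) where

      x : Fin (length us) → Colour → ℚ
      x k w = rec (G ∖ v ∖ v₁) (prune L us k w) (lookup us k) w

      q y : Colour → ℚ
      q w = ∏ (allFin (length us)) λ k → 1ℚ − x k w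
      y j = rec (G ∖ v) (L₂ j) v₂ j

      x-bounds : ∀ k w → ½ ≤ 1ℚ − x k w × 1ℚ − x k w ≤ 1ℚ
      x-bounds k w = 1-x-bounds B.0≤ B.≤½
        where module B = Bounds (bounded (reachable-∖ {G = G ∖ v} {v₁} (nbrs-↭ (G ∖ v) v₁) (admissible-∖ v A) k w) w)

      q-bounds : ∀ w → ½^ d ≤ q w × q w ≤ 1ℚ × 0ℚ ≤ q w
      q-bounds w = subst (λ m → ½^ m ≤ q w × q w ≤ 1ℚ × 0ℚ ≤ q w)
        (trans (length-tabulate (λ k → k)) (length-nbrs (G ∖ v) v₁))
        (∏-bounds (λ k → proj₁ (x-bounds k w)) (λ k → proj₂ (x-bounds k w)) (allFin (length us)))

      module N = Normalised (L v₁) q (suc d) (½^ d)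
        (proj₁ (½^-bounds (Reachable.deg≤2 R₁))) (proj₂ (½^-bounds (Reachable.deg≤2 R₁)))
        (list≥deg+2 R₁) (λ w → proj₁ (q-bounds w)) (λ w → proj₁ (proj₂ (q-bounds w)))

      module Y j = Bounds (bounded (R₂ j) j)

      open Weights N.f y N.0≤f N.f≤4/7 N.∑f≡1 Y.0≤ Y.≤½ public

      -- The quantities of `Step.deg-2` are repeated here term by term, and the elements of the full
      -- palette reduce to `allFin 4`, so only the list of `v` has to be rewritten.
      deg-2≡ : L v ≡ ⊤ → ∀ i → Step.deg-2 rec G L v i (v₁ , v₂) ≡ g i ÷₀ ∑ (allFin 4) g
      deg-2≡ full i = cong (λ p → g i ÷₀ ∑ (elements p) g) full

  by-degree-2 : ∀ rec {G L v i vs} → length vs ≡ 2 → Step.by-degree rec G L v i vs ≡ Step.deg-2 rec G L v i (pair G L v i)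
  by-degree-2 rec {vs = _ ∷ _ ∷ []} _ = refl

  module Degree2 {G : Graph n} {L : ListAssignment n} {v : Fin n} {i : Colour}
    (R : Reachable G L v) (deg≡2 : deg G v ≡ 2) where

    v₁ v₂ : Fin n
    v₁ = proj₁ (pair G L v i)
    v₂ = proj₂ (pair G L v i)

    -- Two colours more than the degree exhaust all four, so every colour is available at `v`.
    full : L v ≡ ⊤
    full = n≤∣p∣⇒p≡⊤ (subst (λ d → 2 +ℕ d ≤ℕ ∣ L v ∣) deg≡2 (list≥deg+2 R))

    open Fork {G} {L} {v} {v₁} {v₂} (reachable⇒admissible R) (pair-↭ G L v i deg≡2) public

    next≡ : ∀ {rec} (bounded : Bounded rec) → let open Evaluation bounded in next rec G L v i ≡ g i ÷₀ ∑ (allFin 4) g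
    next≡ {rec} bounded = trans (next-∈ rec (subst (i ∈_) (sym full) ∈⊤))
      (trans (by-degree-2 rec {vs = nbrs G v} (trans (length-nbrs G v) deg≡2)) (Evaluation.deg-2≡ bounded full i))

  data Degree (G : Graph n) (v : Fin n) : Set where
    isolated : nbrs G v ≡ [] → Degree G v
    leaf     : ∀ u → nbrs G v ≡ u ∷ [] → Degree G v
    fork     : deg G v ≡ 2 → Degree G v

  degree : ∀ {G L v} → Reachable G L v → Degree G v
  degree {G} {L} {v} R with nbrs G v in e | length-nbrs G v
  ... | []            | _  = isolated e
  ... | u ∷ []        | _  = leaf u e
  ... | _ ∷ _ ∷ []    | l  = fork (sym l)
  ... | _ ∷ _ ∷ _ ∷ _ | l with s≤s (s≤s ()) ← subst (_≤ℕ 2) (sym l) (Reachable.deg≤2 R)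

  next-isolated : ∀ {G L v i} rec → nbrs G v ≡ [] → i ∈ L v → next rec G L v i ≡ reciprocal-size (L v)
  next-isolated {G} {L} {v} {i} rec e i∈ = trans (next-∈ rec i∈) (cong (Step.by-degree rec G L v i) e)

  -- Degrees 0 and 1 yield the range from 1/6 to 1/2. Only degree 2 falls back to 1/14, and there
  -- `lower-leaf` is vacuous.
  next-bounded : ∀ {rec} → Bounded rec → Bounded (next rec)
  next-bounded {rec} bounded {G} {L} {v} R i = cases (i ∈? L v) (degree R)
    where
    from-range : i ∈ L v → + 1 / 6 ≤ next rec G L v i × next rec G L v i ≤ ½ → Bounds G L v i (next rec G L v i)
    from-range i∈ (lo , hi) = record
      { absent     = λ i∉ → contradiction i∈ i∉
      ; ≤½         = hi
      ; lower      = λ _ → ≤-trans ≤! lo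
      ; lower-leaf = λ _ _ → lo
      }

    cases : Dec (i ∈ L v) → Degree G v → Bounds G L v i (next rec G L v i)
    cases (no i∉) _ = subst (Bounds G L v i) (sym (next-∉ rec i∉)) record
      { absent     = λ _ → refl
      ; ≤½         = ≤!
      ; lower      = λ i∈ → contradiction i∈ i∉
      ; lower-leaf = λ i∈ → contradiction i∈ i∉
      }
    cases (yes i∈) (isolated e) = from-range i∈ (subst (λ z → + 1 / 6 ≤ z × z ≤ ½) (sym (next-isolated rec e i∈))
      (reciprocal-bounds {L v} (ℕₚ.≤-trans (ℕₚ.m≤m+n 2 _) (list≥deg+2 R))))
    cases (yes i∈) (leaf u e) = from-range i∈ (Leaf.next-range R e i∈ bounded)
    cases (yes i∈) (fork deg≡2) = subst (Bounds G L v i) (sym (next≡ bounded)) record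
      { absent     = λ i∉ → contradiction i∈ i∉
      ; ≤½         = g÷∑g≤½ i
      ; lower      = λ _ → g÷∑g≥1/14 i
      ; lower-leaf = λ _ deg≤1 → case subst (_≤ℕ 1) deg≡2 deg≤1 of λ { (s≤s ()) }
      }
      where
      open Degree2 {i = i} R deg≡2
      open Evaluation bounded

  P-bounded : ∀ D → Bounded (λ G L v i → P G L v i (+ D))
  P-bounded 0       = base-bounded
  P-bounded (suc D) = next-bounded (P-bounded D)

  -- The dichotomy between 1/2 and 13/27

  Cases : Graph n → ListAssignment n → Fin n → Colour → Set
  Cases G L v i = CaseA G L v i ⊎ CaseB G L v i ⊎ CaseC G L v i

  -- Two unfoldings are needed: one at `v`, one to evaluate the `y j` at `v₂` when `v` has degree 2;
  -- below that the invariant suffices. Hence the threshold 2 for the depth. The alternative is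
  -- chosen before `rec`, so it is the same at all depths.
  Verdict : Graph n → ListAssignment n → Fin n → Colour → Set
  Verdict G L v i =
    (Cases G L v i × (∀ {rec} → Bounded rec → next (next rec) G L v i ≡ ½))
    ⊎ (∀ {rec} → Bounded rec → next (next rec) G L v i ≤ + 13 / 27 × (deg G v ≤ℕ 1 → next (next rec) G L v i ≤ + 6 / 13))

  module _ {G : Graph n} {L : ListAssignment n} {v : Fin n} {i : Colour} (R : Reachable G L v) where

    below-6/13 : (∀ {rec} → Bounded rec → next (next rec) G L v i ≤ + 6 / 13) → Verdict G L v i
    below-6/13 le = inj₂ λ b → ≤-trans (le b) ≤! , λ _ → le b

    verdict-isolated : nbrs G v ≡ [] → i ∈ L v → Verdict G L v i
    verdict-isolated e i∈ with ∣ L v ∣ ℕₚ.≟ 2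
    ... | no ≢2 = below-6/13 λ {rec} b → subst (_≤ + 6 / 13) (sym (next-isolated (next rec) e i∈))
      (≤-trans (reciprocal≤1/3 {L v} (ℕₚ.≤∧≢⇒< (ℕₚ.≤-trans (ℕₚ.m≤m+n 2 _) (list≥deg+2 R)) (≢2 ∘ sym))) ≤!)
    ... | yes ≡2 with j , w , j≢w , j∉ , w∉ ← two-missing {L v} (ℕₚ.≤-reflexive ≡2) = inj₁
      ( inj₁ ( trans (sym (length-nbrs G v)) (cong length e)
             , j , w , j≢w , (λ { refl → j∉ i∈ }) , (λ { refl → w∉ i∈ }) , j∉ , w∉)
      , λ {rec} _ → trans (next-isolated (next rec) e i∈) (reciprocal≡½ {L v} ≡2))

    verdict-leaf : ∀ {u} → nbrs G v ≡ u ∷ [] → i ∈ L v → Verdict G L v i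
    verdict-leaf {u} e i∈ with Leaf.full-or-missing R e
    ... | inj₁ full = below-6/13 λ {rec} b → subst (_≤ + 6 / 13) (sym (Leaf.next-full R e i∈ full (next rec)))
      (≤-trans ([1-x]÷3≤1/3 (Bounds.0≤ (next-bounded b (Leaf.Rᵤ R e) i))) ≤!)
    ... | inj₂ (j , j∉) with i ∈? L u | j ∈? L u
    ...   | yes i∈u | _       = below-6/13 λ b → Leaf.Missing.next≤6/13 R e i∈ j∉ (next-bounded b) (inj₁ i∈u)
    ...   | _       | yes j∈u = below-6/13 λ b → Leaf.Missing.next≤6/13 R e i∈ j∉ (next-bounded b) (inj₂ j∈u)
    ...   | no i∉u  | no j∉u  = inj₁
      ( inj₂ (inj₁ ( Leaf.deg≡1 R e , u , Leaf.u∈nbhd R e , i∉u , j , (λ { refl → j∉ i∈ })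
                   , [ j∉u , j∉ ]′ ∘ x∈p∪q⁻ (L u) (L v)))
      , λ b → Leaf.Missing.next≡½ R e i∈ j∉ (next-bounded b) i∉u j∉u)

    module _ (deg≡2 : deg G v ≡ 2) where
      open Degree2 {i = i} R deg≡2
      -- The values at the children are taken from `next rec`, so each `y j` can itself be unfolded
      -- once.
      module Eval {rec} (b : Bounded rec) = Evaluation (next-bounded b)

      below-13/27 : (∀ {rec} (b : Bounded rec) → let open Eval b in g i ÷₀ ∑ (allFin 4) g ≤ + 13 / 27) → Verdict G L v i
      below-13/27 le = inj₂ λ b → subst (_≤ + 13 / 27) (sym (next≡ (next-bounded b))) (le b) ,
        λ deg≤1 → case subst (_≤ℕ 1) deg≡2 deg≤1 of λ { (s≤s ()) }

      module _ (i∉₁ : i ∉ L v₁) (i∉₂ : i ∉ L v₂) where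

        i∉L₂v₂ : ∀ j → i ∉ L₂ j v₂
        i∉L₂v₂ j = subst (i ∉_) (sym (L₂v₂≡ j)) i∉₂

        module Case {rec} (b : Bounded rec) where
          open Eval b public
          fᵢ≡0 = N.f-∉ i∉₁
          yᵢ≡0 = Y.absent i (i∉L₂v₂ i)
          -- As `i` is missing at `v₁`, at most one neighbour of `v₁` remains, which improves 4/7 to
          -- 1/2.
          f≤½  = N.f≤½ (½^-bound₁ (missing⇒deg≤1 R₁ i∉₁))

        -- One colour with `y j` at most 1/3 is enough. If the list of `v₂` has three colours, any
        -- of them will do; otherwise a second colour besides `i` is missing there, and its `y j` is
        -- 0.
        verdict-isolated₂ : nbrs (G ∖ v) v₂ ≡ [] → Verdict G L v i
        verdict-isolated₂ e with 3 ℕₚ.≤? ∣ L v₂ ∣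
        ... | yes 3≤ = below-13/27 λ {rec} b → let open Case b in
          g÷∑g≤13/27-some fᵢ≡0 yᵢ≡0 f≤½ 1 (L v₂) (+ 1 / 3) i∉₂ (ℕₚ.≤-trans (s≤s z≤n) 3≤) λ j j∈ →
            subst (_≤ + 1 / 3)
              (sym (trans (next-isolated rec e (subst (j ∈_) (sym (L₂v₂≡ j)) j∈)) (cong reciprocal-size (L₂v₂≡ j))))
              (reciprocal≤1/3 {L v₂} 3≤)
        ... | no 3≰ with j , j≢i , j∉ ← other-missing {L v₂} i (ℕₚ.≤-pred (ℕₚ.≰⇒> 3≰)) = below-13/27 λ b → let open Case b in
          g÷∑g≤13/27-some fᵢ≡0 yᵢ≡0 f≤½ 1 ⁅ j ⁆ (+ 1 / 3) (j≢i ∘ sym ∘ x∈⁅y⁆⇒x≡y j) (ℕₚ.≤-reflexive (sym (∣⁅x⁆∣≡1 j))) λ w w∈ →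
            subst (λ z → y z ≤ + 1 / 3) (sym (x∈⁅y⁆⇒x≡y j w∈))
              (subst (_≤ + 1 / 3) (sym (Y.absent j (subst (j ∉_) (sym (L₂v₂≡ j)) j∉))) ≤!)

        module _ {u} (e : nbrs (G ∖ v) v₂ ≡ u ∷ []) where

          -- A vertex of degree 1 at the root has at least three colours, so `i` is the only one
          -- missing at `v₂`.
          j∈L₂v₂ : ∀ {j} → j ≢ i → j ∈ L₂ j v₂
          j∈L₂v₂ {j} j≢i = decidable-stable (j ∈? L₂ j v₂) λ j∉ →
            case ℕₚ.≤-trans (s≤s (s≤s (Leaf.3≤list (R₂ j) e))) (x,y∉p⇒2+∣p∣≤n j∉ (i∉L₂v₂ j) j≢i) of
              λ { (s≤s (s≤s (s≤s (s≤s ())))) }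

          -- The roles are exchanged relative to `Leaf.Missing`: the colour evaluated at `v₂` is `j`
          -- and the missing one is `i`.
          module Leaf₂ {j} (j≢i : j ≢ i) {rec} (b : Bounded rec) = Leaf.Missing (R₂ j) e (j∈L₂v₂ j≢i) (i∉L₂v₂ j) b

          -- The only remaining neighbour of `v₂` is `v₁`, whose list has lost `j` by pruning and
          -- never contained `i`. Both colours being absent, `y j` is 1/2 for every `j ≢ i`.
          verdict-triangle : u ≡ v₁ → Verdict G L v i
          verdict-triangle refl = inj₁
            ( inj₂ (inj₂ ( deg≡2 , v₁ , v₂ , v₁≢v₂ , ∈vs⇒∈nbhd {G = G} {v} σ (here refl) , ∈vs⇒∈nbhd {G = G} {v} σ (there (here refl))
                         , nbhd-∖⊆ G v (Leaf.u∈nbhd (R₂ i) e)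
                         , [ i∉₁ , i∉₂ ]′ ∘ x∈p∪q⁻ (L v₁) (L v₂)))
            , λ b → let open Case b in trans (next≡ (next-bounded b)) (g÷∑g≡½ fᵢ≡0 yᵢ≡0 λ j j≢i →
                Leaf₂.next≡½ j≢i b (subst (j ∉_) (sym (L₂v₁≡ j)) (x∉p-x (L v₁) j))
                                   (subst (i ∉_) (sym (L₂v₁≡ j)) (i∉₁ ∘ p─q⊆p _ _))))
            where σ = pair-↭ G L v i deg≡2

          -- The list of `u` is not pruned. If it contains `i`, every `y j` with `j ≢ i` is at most
          -- 6/13. If not, the colours in it, at least two, have `y j` at most 5/12.
          verdict-no-triangle : u ≢ v₁ → Verdict G L v i
          verdict-no-triangle u≢v₁ with i ∈? L u
          ... | yes i∈u = below-13/27 λ b → let open Case b in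
            g÷∑g≤13/27-all fᵢ≡0 yᵢ≡0 λ j j≢i → Leaf₂.next≤6/13 j≢i b (inj₂ (subst (i ∈_) (sym (L₂≡L j u≢v₁)) i∈u))
          ... | no  i∉u = below-13/27 λ b → let open Case b in
            g÷∑g≤13/27-some fᵢ≡0 yᵢ≡0 f≤½ 2 (L u) (+ 5 / 12) i∉u 2≤ λ j j∈ →
              Leaf₂.next≤5/12 (λ { refl → i∉u j∈ }) b
                (subst (j ∈_) (sym (L₂≡L j u≢v₁)) j∈) (subst (i ∉_) (sym (L₂≡L j u≢v₁)) i∉u)
            where
            2≤ : 2 ≤ℕ ∣ L u ∣
            2≤ = subst (λ p → 2 ≤ℕ ∣ p ∣) (L₂≡L i u≢v₁)
              (ℕₚ.≤-trans (ℕₚ.m≤m+n 2 _) (list≥deg+2 (Leaf.Rᵤ (R₂ i) e)))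

        verdict-∉ : Verdict G L v i
        verdict-∉ with degree (R₂ i)
        ... | isolated e = verdict-isolated₂ e
        ... | leaf u e with u ≟ v₁
        ...   | yes u≡v₁ = verdict-triangle e u≡v₁
        ...   | no  u≢v₁ = verdict-no-triangle e u≢v₁
        verdict-∉ | fork d≡2 = case subst (_≤ℕ 1) d≡2 (missing⇒deg≤1 (R₂ i) (i∉L₂v₂ i)) of λ { (s≤s ()) }

      verdict-fork : Verdict G L v i
      verdict-fork with i ∈? L v₁ | i ∈? L v₂
      ... | yes i∈₁ | _       = below-13/27 λ b → let open Eval b in g÷∑g≤13/27-f {i} (N.f≥1/13 i∈₁)
      ... | _       | yes i∈₂ = below-13/27 λ b → let open Eval b in
        g÷∑g≤13/27-y {i} (Y.lower i (subst (i ∈_) (sym (L₂v₂≡ i)) i∈₂))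
      ... | no i∉₁  | no i∉₂  = verdict-∉ i∉₁ i∉₂

    verdict : Verdict G L v i
    verdict = cases (i ∈? L v) (degree R)
      where
      cases : Dec (i ∈ L v) → Degree G v → Verdict G L v i
      cases (no  i∉) _            = below-6/13 λ {rec} _ → subst (_≤ + 6 / 13) (sym (next-∉ (next rec) i∉)) ≤!
      cases (yes i∈) (isolated e) = verdict-isolated e i∈
      cases (yes i∈) (leaf u e)   = verdict-leaf e i∈
      cases (yes _)  (fork deg≡2) = verdict-fork deg≡2

theorem11 : ∀ {n : ℕ} (O : Orders n) → let open Procedure O using (P) in
    ∀ (G : Graph n) (L : ListAssignment n) (v : Fin n) (i : Colour) →
    Reachable G L v →
    ( (∀ (D : ℤ) → + 2 ≤ℤ D → P G L v i D ≡ ½)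
    ⊎ ( (∀ (D : ℤ) → + 2 ≤ℤ D → P G L v i D ≤ + 13 / 27)
    × (deg G v ≤ℕ 1 → ∀ (D : ℤ) → + 2 ≤ℤ D → P G L v i D ≤ + 6 / 13)))
    × ( (∃[ D ] + 2 ≤ℤ D × P G L v i D ≡ ½)
    → CaseA G L v i ⊎ CaseB G L v i ⊎ CaseC G L v i)
theorem11 O G L v i R with Analysis.verdict O {i = i} R
... | inj₁ (cases , ≡½) =
  -- The depth `+[1+ suc D ]` is `D` + 2, which is definitionally two steps applied to the procedure
  -- at depth `D`.
  inj₁ (λ { +[1+ suc D ] _ → ≡½ (P-bounded D) ; +[1+ 0 ] (+≤+ (s≤s ())) ; (+ 0) (+≤+ ()) }) , λ _ → cases
  where open Analysis O
... | inj₂ bound =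
  inj₂ ( (λ { +[1+ suc D ] _ → proj₁ (bound (P-bounded D)) ; +[1+ 0 ] (+≤+ (s≤s ())) ; (+ 0) (+≤+ ()) })
       , (λ { deg≤1 +[1+ suc D ] _ → proj₂ (bound (P-bounded D)) deg≤1 ; _ +[1+ 0 ] (+≤+ (s≤s ())) ; _ (+ 0) (+≤+ ()) }))
  , λ { (+[1+ suc D ] , _ , P≡½) → contradiction (subst (_≤ + 13 / 27) P≡½ (proj₁ (bound (P-bounded D)))) (toWitnessFalse {a? = ½ ≤? + 13 / 27} _)
      ; (+[1+ 0 ] , +≤+ (s≤s ()) , _) ; (+ 0 , +≤+ () , _) }
  where open Analysis O
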